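{- Let $M$ be a simply connected digital 2-manifold. Then $M$ is a digital 2-sphere.
   Context: A digital space is a simple undirected graph with a finite or countable set of points (vertices). For a point $v$ of a digital space $G$, the rim $O(v)$ is the induced subgraph of $G$ on all points adjacent to $v$ (without $v$ itself). $G-v$ denotes the induced subgraph obtained by deleting $v$. A point $v$ is simple in $G$ if $O(v)$ is contractible, where a graph is contractible if it can be converted to the trivial (one-point) graph by sequentially deleting simple points (each simple in the current graph; the trivial graph is contractible). A digital 0-sphere is a graph consisting of exactly two non-adjacent points. Recursively, for $n>0$, a digital $n$-sphere is a connected digital space $M$ such that for every point $v\in M$ the rim $O(v)$ is a digital $(n-1)$-sphere and $M-v$ is contractible. For $n>1$, a digital $n$-manifold is a connected digital space $M$ such that the rim $O(v)$ of every point $v$ is a digital $(n-1)$-sphere. A closed curve is a digital 1-sphere (equivalently, a finite cycle in which the rim of each point is a pair of non-adjacent points). For graphs, $H\subseteq G$ means that $H$ is a (not necessarily induced) subgraph of $G$, i.e. $H$ is obtained from $G$ by deleting points and edges. A connected digital space $M$ is simply connected if for every closed curve $C\subseteq M$ there is a contractible graph $A$ with $C\subseteq A\subseteq M$.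
   Formalization: M is assumed to have finitely many points; for countable M the statement fails: the triangular lattice of the plane is a simply connected digital 2-manifold but not a digital 2-sphere, since deleting a point leaves an infinite, hence non-contractible, graph. -}

module Defs where

open import Data.Bool using (Bool; T; _∧_; not)
open import Data.Bool.Properties using (T-∧)
open import Data.Nat using (ℕ; zero; suc; pred; _<_; _≡ᵇ_)
open import Data.Product using (_×_; _,_; ∃; ∃-syntax; proj₁; proj₂)
open import Data.Sum using (_⊎_)
open import Function.Bundles using (Equivalence)
open import Relation.Binary.Construct.Closure.ReflexiveTransitive using (Star)
open import Relation.Binary.PropositionalEquality using (_≡_; _≢_)
open import Relation.Nullary using (¬_)

-- A simple undirected graph with a finite or countable set of points: the
-- points are labelled by natural numbers, so that deletions, rims and
-- subgraphs of a space are again spaces over the same labels.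
record DigitalSpace : Set where
  field
    point       : ℕ → Bool
    edge        : ℕ → ℕ → Bool
    edge-irrefl : ∀ x → ¬ T (edge x x)
    edge-sym    : ∀ x y → T (edge x y) → T (edge y x)
    edge-point  : ∀ x y → T (edge x y) → T (point x)

open DigitalSpace public

infix 4 _∈_ _⊆_ _⊢_~_

_∈_ : ℕ → DigitalSpace → Set
x ∈ G = T (point G x)

_⊢_~_ : DigitalSpace → ℕ → ℕ → Set
G ⊢ x ~ y = T (edge G x y)

-- Not necessarily induced subgraphs.
_⊆_ : DigitalSpace → DigitalSpace → Set
H ⊆ G = (∀ x → x ∈ H → x ∈ G) × (∀ x y → H ⊢ x ~ y → G ⊢ x ~ y)

-- Every digital sphere is finite, since contractible spaces are, but manifolds
-- in the sense below need not be (e.g. the triangular lattice in the plane).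
Finite : DigitalSpace → Set
Finite G = ∃[ n ] (∀ x → x ∈ G → x < n)

private
  split : ∀ {a b} → T (a ∧ b) → T a × T b
  split = Equivalence.to T-∧

  pair : ∀ {a b} → T a × T b → T (a ∧ b)
  pair = Equivalence.from T-∧

induced : DigitalSpace → (ℕ → Bool) → DigitalSpace
induced G p = record
  { point       = λ x → point G x ∧ p x
  ; edge        = λ x y → edge G x y ∧ (p x ∧ p y)
  ; edge-irrefl = λ x e → edge-irrefl G x (proj₁ (split {edge G x x} e))
  ; edge-sym    = λ x y e →
      let (g , q) = split {edge G x y} e ; (px , py) = split {p x} q
      in pair (edge-sym G x y g , pair (py , px))
  ; edge-point  = λ x y e →
      let (g , q) = split {edge G x y} e ; (px , _) = split {p x} q
      in pair (edge-point G x y g , px)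
  }

rim : DigitalSpace → ℕ → DigitalSpace
rim G v = induced G (edge G v)

infixl 6 _-_

_-_ : DigitalSpace → ℕ → DigitalSpace
G - v = induced G (λ x → not (x ≡ᵇ v))

Trivial : DigitalSpace → Set
Trivial G = ∃[ x ] (x ∈ G × (∀ y → y ∈ G → y ≡ x))

data Contractible : DigitalSpace → Set

Simple : DigitalSpace → ℕ → Set
Simple G v = v ∈ G × Contractible (rim G v)

data Contractible where
  trivial : ∀ {G} → Trivial G → Contractible G
  delete  : ∀ {G} v → Simple G v → Contractible (G - v) → Contractible G

-- The empty graph is not counted as connected.
Connected : DigitalSpace → Set
Connected G = ∃ (_∈ G) × (∀ x y → x ∈ G → y ∈ G → Star (G ⊢_~_) x y)

IsSphere : ℕ → DigitalSpace → Set
IsSphere zero    G = ∃[ x ] ∃[ y ]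
  (x ∈ G × y ∈ G × x ≢ y × ¬ (G ⊢ x ~ y) × (∀ z → z ∈ G → z ≡ x ⊎ z ≡ y))
IsSphere (suc n) G =
  Connected G × (∀ v → v ∈ G → IsSphere n (rim G v) × Contractible (G - v))

IsManifold : ℕ → DigitalSpace → Set
IsManifold n M =
  1 < n × Connected M × (∀ v → v ∈ M → IsSphere (pred n) (rim M v))

ClosedCurve : DigitalSpace → Set
ClosedCurve = IsSphere 1

SimplyConnected : DigitalSpace → Set
SimplyConnected M = Connected M ×
  (∀ C → ClosedCurve C → C ⊆ M → ∃[ A ] (Contractible A × C ⊆ A × A ⊆ M))

{-# OPTIONS --safe #-}

-- Work with cohomology modulo 2. A contractible space is connected and every
-- cocycle on it is a coboundary; since every closed walk of a simply connected
-- M decomposes, by erasing loops, into triangles and closed curves lying in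
-- contractible subgraphs, H¹(M) = 0. Counting, modulo 2, the triangles at each
-- edge of M - v shows that a cocycle on M - v sums to zero around the rim of v,
-- so H¹(M - v) = 0 too. Now dismantle M - v while keeping the remaining induced
-- subgraph G connected with H¹(G) = 0. Among the points of G next to a deleted
-- one there is a point w such that G - w is connected (or G is a single point).
-- By Mayer–Vietoris the rim of w in G is connected; being a proper part of a
-- cycle it is a path, hence w is simple, and again by Mayer–Vietoris H¹(G - w) = 0.
module Submission where

open import Algebra.Bundles using (CommutativeRing)
import Algebra.Properties.Semiring.Sum as Summation
open import Data.Bool as Bool using (Bool; true; false; T; not; _∧_; _∨_; _xor_; if_then_else_)
open import Data.Bool.Properties
  using (T-∧; T-∨; T-≡; T?; ∧-identityʳ; xor-same; xor-identityʳ; xor-comm; xor-assoc; xor-∧-commutativeRing)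
open import Data.Bool.Solver using (module xor-∧-Solver)
open import Data.Empty using (⊥; ⊥-elim)
open import Data.Fin using (toℕ)
open import Data.List using (List; []; _∷_; _++_; length)
open import Data.List.Membership.Propositional using () renaming (_∈_ to _∈ˡ_; _∉_ to _∉ˡ_)
open import Data.List.Membership.Propositional.Properties using (∈-++⁺ʳ; ∈-++⁻; ∈-∃++)
open import Data.List.Properties using (++-assoc)
open import Data.List.Relation.Binary.Permutation.Propositional using (_↭_; ↭⇒↭ₛ)
open import Data.List.Relation.Binary.Permutation.Propositional.Properties using (++-comm; shift; ∈-resp-↭; ↭-length)
import Data.List.Relation.Binary.Permutation.Setoid.Properties as Permutation
open import Data.List.Relation.Unary.All using ([]; _∷_)
open import Data.List.Relation.Unary.All.Properties using (¬Any⇒All¬; All¬⇒¬Any; ++⁻ˡ)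
open import Data.List.Relation.Unary.AllPairs using ([]; _∷_)
open import Data.List.Relation.Unary.Any using (here; there)
open import Data.List.Relation.Unary.Unique.Propositional using (Unique)
open import Data.Nat using (ℕ; zero; suc; pred; _+_; _<_; _≤_; z≤n; s≤s; _≟_; _≡ᵇ_; _<ᵇ_)
open import Data.Nat.Properties
  using (≡⇒≡ᵇ; ≡ᵇ⇒≡; anyUpTo?; +-mono-≤; +-mono-<-≤; +-mono-≤-<; m<1+n⇒m<n∨m≡n; <-≤-trans; ≤-refl)
open import Data.List.Membership.DecPropositional _≟_ using (_∈?_)
open import Data.Product using (_×_; _,_; ∃; ∃-syntax; proj₁; proj₂)
open import Data.Sum as Sum using (_⊎_; inj₁; inj₂)
open import Function.Bundles using (Equivalence)
open import Relation.Binary.Construct.Closure.ReflexiveTransitive using (Star; ε; _◅_; _◅◅_; reverse)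
open import Relation.Binary.PropositionalEquality
  using (_≡_; _≢_; refl; sym; trans; cong; cong₂; subst; setoid; module ≡-Reasoning)
open import Relation.Nullary using (¬_; Dec; yes; no)
open import Relation.Nullary.Decidable using (_×-dec_; ¬?; map′; ⌊_⌋; toWitness; fromWitness)
open import Relation.Unary using (Decidable)

open import Defs

open xor-∧-Solver using (solve; _:=_; _:+_; _:*_; con)

-- The rim of a point in a proper induced subgraph of a surface is a part of a cycle, so it can fail
-- to be contractible only by being empty, disconnected or the whole cycle. A neighbour outside `G`
-- excludes the whole cycle, connectedness of `G` the empty rim, and H¹(G) = 0 together with
-- connectedness of `G - w` the disconnected one. Simple connectedness is not obviously inherited by
-- `M - v`, since the contractible `A` around a curve may pass through `v`. Cohomology is inherited:
-- every edge of `M` lies in exactly two triangles, so modulo 2 the triangles that avoid `v` form a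
-- chain whose boundary is the rim of `v`, and a cocycle sums to zero along a boundary. Coefficients
-- modulo 2 make this work without an orientation, and they turn cochains into Boolean functions. A
-- boundary point of `G` may be a cut point, so `w` has to be chosen: all other boundary points must
-- lie in one connected set that avoids `w`.

private
  variable
    A : Set

-- Points and edges of deletions and rims

T-split : ∀ {a b} → T (a ∧ b) → T a × T b
T-split = Equivalence.to T-∧

T-pair : ∀ {a b} → T a → T b → T (a ∧ b)
T-pair p q = Equivalence.from T-∧ (p , q)

≢⇒T-not : ∀ {x v} → x ≢ v → T (not (x ≡ᵇ v))
≢⇒T-not {x} {v} x≢v with x ≡ᵇ v in eq
... | true  = x≢v (≡ᵇ⇒≡ x v (subst T (sym eq) _))
... | false = _

T-not⇒≢ : ∀ {x v} → T (not (x ≡ᵇ v)) → x ≢ v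
T-not⇒≢ {x} {v} t eq with x ≡ᵇ v | ≡⇒≡ᵇ x v eq
... | true | _ = t

neighbour : ∀ G {x y} → G ⊢ x ~ y → y ∈ G
neighbour G {x} {y} e = edge-point G y x (edge-sym G x y e)

edge⇒≢ : ∀ G {x y} → G ⊢ x ~ y → x ≢ y
edge⇒≢ G {x} e refl = edge-irrefl G x e

∈-⁻ : ∀ G v {x} → x ∈ G - v → x ∈ G × x ≢ v
∈-⁻ G v {x} p with q , r ← T-split {point G x} p = q , T-not⇒≢ r

∈-⁺ : ∀ G v {x} → x ∈ G → x ≢ v → x ∈ G - v
∈-⁺ G v {x} p q = T-pair {point G x} p (≢⇒T-not q)

~-⁻ : ∀ G v {x y} → G - v ⊢ x ~ y → G ⊢ x ~ y × x ≢ v × y ≢ v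
~-⁻ G v {x} {y} e with p , q ← T-split {edge G x y} e
  with r , s ← T-split {not (x ≡ᵇ v)} q = p , T-not⇒≢ r , T-not⇒≢ s

~-⁺ : ∀ G v {x y} → G ⊢ x ~ y → x ≢ v → y ≢ v → G - v ⊢ x ~ y
~-⁺ G v {x} {y} e p q = T-pair {edge G x y} e (T-pair {not (x ≡ᵇ v)} (≢⇒T-not p) (≢⇒T-not q))

∈-rim⁻ : ∀ G v {x} → x ∈ rim G v → G ⊢ v ~ x
∈-rim⁻ G v {x} p = proj₂ (T-split {point G x} p)

∈-rim⁺ : ∀ G v {x} → G ⊢ v ~ x → x ∈ rim G v
∈-rim⁺ G v {x} e = T-pair {point G x} (neighbour G e) e

~-rim⁻ : ∀ G v {x y} → rim G v ⊢ x ~ y → G ⊢ x ~ y × G ⊢ v ~ x × G ⊢ v ~ y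
~-rim⁻ G v {x} {y} e with p , q ← T-split {edge G x y} e
  with r , s ← T-split {edge G v x} q = p , r , s

~-rim⁺ : ∀ G v {x y} → G ⊢ x ~ y → G ⊢ v ~ x → G ⊢ v ~ y → rim G v ⊢ x ~ y
~-rim⁺ G v {x} {y} e p q = T-pair {edge G x y} e (T-pair {edge G v x} p q)

-- Zeroth and first cohomology with coefficients in the field of two elements

LocallyConstant : DigitalSpace → (ℕ → Bool) → Set
LocallyConstant G g = ∀ {x y} → G ⊢ x ~ y → g x ≡ g y

-- Connectedness as a statement on H⁰: there are no locally constant functions but the constant
-- ones. In this dual form it extends and restricts along with cochains; the empty graph satisfies
-- it too.
Conn : DigitalSpace → Set
Conn G = ∀ g → LocallyConstant G g → ∀ {x y} → x ∈ G → y ∈ G → g x ≡ g y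

-- A 1-cocycle of the clique complex of `G`. Values off the edges are left arbitrary, so that
-- restriction to a subgraph keeps the same `φ`.
record Cocycle (G : DigitalSpace) (φ : ℕ → ℕ → Bool) : Set where
  field
    symmetric : ∀ {x y} → G ⊢ x ~ y → φ x y ≡ φ y x
    triangle  : ∀ {x y z} → G ⊢ x ~ y → G ⊢ y ~ z → G ⊢ x ~ z → φ x y xor φ y z ≡ φ x z

open Cocycle

_isCoboundaryOf_on_ : (ℕ → ℕ → Bool) → (ℕ → Bool) → DigitalSpace → Set
φ isCoboundaryOf f on G = ∀ {x y} → G ⊢ x ~ y → φ x y ≡ f x xor f y

Acyclic : DigitalSpace → Set
Acyclic G = ∀ φ → Cocycle G φ → ∃[ f ] φ isCoboundaryOf f on G

Connected⇒Conn : ∀ {G} → Connected G → Conn G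
Connected⇒Conn {G} (_ , path) g lc p q = along (path _ _ p q)
  where
  along : ∀ {x y} → Star (G ⊢_~_) x y → g x ≡ g y
  along ε       = refl
  along (e ◅ s) = trans (lc e) (along s)

cocycle-⊆ : ∀ {G H φ} → (∀ {x y} → H ⊢ x ~ y → G ⊢ x ~ y) → Cocycle G φ → Cocycle H φ
cocycle-⊆ i c = record
  { symmetric = λ e → symmetric c (i e)
  ; triangle  = λ e e′ e″ → triangle c (i e) (i e′) (i e″)
  }

infixl 8 _[_↦_]

_[_↦_] : (ℕ → A) → ℕ → A → ℕ → A
(f [ v ↦ a ]) x = if x ≡ᵇ v then a else f x

update-at : ∀ (f : ℕ → A) v a → (f [ v ↦ a ]) v ≡ a
update-at f v a with v ≡ᵇ v | ≡⇒≡ᵇ v v refl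
... | true | _ = refl

update-off : ∀ (f : ℕ → A) v a {x} → x ≢ v → (f [ v ↦ a ]) x ≡ f x
update-off f v a {x} x≢v with x ≡ᵇ v | ≡ᵇ⇒≡ x v
... | true  | eq = ⊥-elim (x≢v (eq _))
... | false | _  = refl

xor-cancel : ∀ a b → a xor b ≡ false → a ≡ b
xor-cancel false false _ = refl
xor-cancel true  true  _ = refl

xor-swapʳ : ∀ a b c → a xor b ≡ c → a ≡ c xor b
xor-swapʳ a b _ refl = solve 2 (λ a b → a := (a :+ b) :+ b) refl a b

coboundary-cocycle : ∀ {G φ f} → φ isCoboundaryOf f on G → Cocycle G φ
coboundary-cocycle {G} {f = f} δ = record
  { symmetric = λ {x} {y} e → trans (δ e) (trans (xor-comm (f x) (f y)) (sym (δ (edge-sym G x y e))))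
  ; triangle  = λ {x} {y} {z} e e′ e″ →
      trans (cong₂ _xor_ (δ e) (δ e′))
            (trans (solve 3 (λ a b c → (a :+ b) :+ (b :+ c) := a :+ c) refl (f x) (f y) (f z)) (sym (δ e″)))
  }

cocycle-xor : ∀ {G φ ψ} → Cocycle G φ → Cocycle G ψ → Cocycle G (λ x y → φ x y xor ψ x y)
cocycle-xor {φ = φ} {ψ} c d = record
  { symmetric = λ e → cong₂ _xor_ (symmetric c e) (symmetric d e)
  ; triangle  = λ {x} {y} {z} e e′ e″ →
      trans (solve 4 (λ a b c d → (a :+ b) :+ (c :+ d) := (a :+ c) :+ (b :+ d)) refl
               (φ x y) (ψ x y) (φ y z) (ψ y z))
            (cong₂ _xor_ (triangle c e e′ e″) (triangle d e e′ e″))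
  }

contractible⇒nonempty : ∀ {G} → Contractible G → ∃ (_∈ G)
contractible⇒nonempty (trivial (x , x∈G , _))  = x , x∈G
contractible⇒nonempty (delete v (v∈G , _) _) = v , v∈G

conn-restore : ∀ {G v u} → G ⊢ v ~ u → Conn (G - v) → Conn G
conn-restore {G} {v} {u} v~u conn g lc {x} {y} x∈ y∈ = trans (to-u x∈) (sym (to-u y∈))
  where
  u∈ : u ∈ G - v
  u∈ = ∈-⁺ G v (neighbour G v~u) (λ u≡v → edge⇒≢ G v~u (sym u≡v))
  to-u : ∀ {x} → x ∈ G → g x ≡ g u
  to-u {x} x∈ with x ≟ v
  ... | yes refl = lc v~u
  ... | no x≢v   = conn g (λ e → lc (proj₁ (~-⁻ G v e))) (∈-⁺ G v x∈ x≢v) u∈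

contractible⇒conn : ∀ {G} → Contractible G → Conn G
contractible⇒conn (trivial (x , _ , only)) g lc p q = cong g (trans (only _ p) (sym (only _ q)))
contractible⇒conn {G} (delete v (_ , R) D) with u , u∈ ← contractible⇒nonempty R =
  conn-restore {G} (∈-rim⁻ G v u∈) (contractible⇒conn D)

contractible⇒acyclic : ∀ {G} → Contractible G → Acyclic G
contractible⇒acyclic {G} (trivial (x , _ , only)) φ c = (λ _ → false) , λ {y} {z} e →
  ⊥-elim (edge⇒≢ G e (trans (only y (edge-point G y z e)) (sym (only z (neighbour G e)))))
contractible⇒acyclic {G} (delete v (v∈G , R) D) φ c
  with u , u∈ ← contractible⇒nonempty R
  with f , δ ← contractible⇒acyclic D φ (cocycle-⊆ {G} {G - v} (λ e → proj₁ (~-⁻ G v e)) c) = f′ , δ′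
  where
  k : ℕ → Bool
  k x = φ v x xor f x
  -- The rim of v is connected, so all its points prescribe the same value at v.
  lc : LocallyConstant (rim G v) k
  lc {x} {y} e with x~y , v~x , v~y ← ~-rim⁻ G v {x} {y} e =
    step (φ v x) (φ x y) (φ v y) (f x) (f y) (triangle c v~x x~y v~y)
      (δ (~-⁺ G v x~y (λ eq → edge⇒≢ G v~x (sym eq)) (λ eq → edge⇒≢ G v~y (sym eq))))
    where
    step : ∀ a b c p q → a xor b ≡ c → b ≡ p xor q → a xor p ≡ c xor q
    step a _ _ p q refl refl = solve 3 (λ a p q → a :+ p := (a :+ (p :+ q)) :+ q) refl a p q
  -- The value at `v` is the one that the edge from `v` to `u` forces; any other point of the rim
  -- would force the same.
  f′ : ℕ → Bool
  f′ = f [ v ↦ k u ]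
  at-v : ∀ {x} → G ⊢ v ~ x → φ v x ≡ f′ v xor f′ x
  at-v {x} v~x = begin
    φ v x          ≡⟨ xor-swapʳ (φ v x) (f x) (k u) (contractible⇒conn R k lc (∈-rim⁺ G v v~x) u∈) ⟩
    k u xor f x    ≡⟨ cong₂ _xor_ (sym (update-at f v (k u)))
                                  (sym (update-off f v (k u) (λ eq → edge⇒≢ G v~x (sym eq)))) ⟩
    f′ v xor f′ x  ∎
    where open ≡-Reasoning
  δ′ : φ isCoboundaryOf f′ on G
  δ′ {x} {y} e with x ≟ v | y ≟ v
  ... | yes refl | yes refl = ⊥-elim (edge-irrefl G x e)
  ... | yes refl | no _ = at-v e
  ... | no _ | yes refl = trans (symmetric c e) (trans (at-v (edge-sym G x y e)) (xor-comm (f′ v) (f′ x)))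
  ... | no x≢v | no y≢v = trans (δ (~-⁺ G v e x≢v y≢v))
          (sym (cong₂ _xor_ (update-off f v (k u) x≢v) (update-off f v (k u) y≢v)))

-- The Mayer–Vietoris sequence of G = (G - w) ∪ star of w: a cochain on G - w
-- that bounds h on the rim of w extends by h to the edges at w.
cone : ℕ → (ℕ → Bool) → (ℕ → ℕ → Bool) → ℕ → ℕ → Bool
cone w h φ = (λ x → φ x [ w ↦ h x ]) [ w ↦ h ]

module _ (w : ℕ) (h : ℕ → Bool) (φ : ℕ → ℕ → Bool) where

  cone-left : ∀ {y} → cone w h φ w y ≡ h y
  cone-left {y} = cong (λ k → k y) (update-at (λ x → φ x [ w ↦ h x ]) w h)

  cone-right : ∀ {x} → x ≢ w → cone w h φ x w ≡ h x
  cone-right {x} x≢w =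
    trans (cong (λ k → k w) (update-off (λ x → φ x [ w ↦ h x ]) w h x≢w)) (update-at (φ x) w (h x))

  cone-off : ∀ {x y} → x ≢ w → y ≢ w → cone w h φ x y ≡ φ x y
  cone-off {x} {y} x≢w y≢w =
    trans (cong (λ k → k y) (update-off (λ x → φ x [ w ↦ h x ]) w h x≢w)) (update-off (φ x) w (h x) y≢w)

  cone-cocycle : ∀ {G} → Cocycle (G - w) φ → φ isCoboundaryOf h on rim G w → Cocycle G (cone w h φ)
  cone-cocycle {G} c δ = record { symmetric = sy ; triangle = tr }
    where
    sy : ∀ {x y} → G ⊢ x ~ y → cone w h φ x y ≡ cone w h φ y x
    sy {x} {y} e with x ≟ w | y ≟ w
    ... | yes refl | yes refl = refl
    ... | yes refl | no y≢w = trans cone-left (sym (cone-right y≢w))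
    ... | no x≢w | yes refl = trans (cone-right x≢w) (sym cone-left)
    ... | no x≢w | no y≢w = trans (cone-off x≢w y≢w) (trans (symmetric c (~-⁺ G w e x≢w y≢w)) (sym (cone-off y≢w x≢w)))
    δ-rim : ∀ {x y} → G ⊢ w ~ x → G ⊢ x ~ y → G ⊢ w ~ y → φ x y ≡ h x xor h y
    δ-rim w~x x~y w~y = δ (~-rim⁺ G w x~y w~x w~y)
    tr : ∀ {x y z} → G ⊢ x ~ y → G ⊢ y ~ z → G ⊢ x ~ z →
         cone w h φ x y xor cone w h φ y z ≡ cone w h φ x z
    tr {x} {y} {z} e e′ e″ with x ≟ w | y ≟ w | z ≟ w
    ... | yes refl | yes refl | _ = ⊥-elim (edge-irrefl G x e)
    ... | _ | yes refl | yes refl = ⊥-elim (edge-irrefl G y e′)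
    ... | yes refl | _ | yes refl = ⊥-elim (edge-irrefl G x e″)
    ... | yes refl | no y≢w | no z≢w = trans (cong₂ _xor_ cone-left (trans (cone-off y≢w z≢w) (δ-rim e e′ e″)))
            (trans (solve 2 (λ a b → a :+ (a :+ b) := b) refl (h y) (h z)) (sym cone-left))
    ... | no x≢w | yes refl | no z≢w = trans (cong₂ _xor_ (cone-right x≢w) cone-left)
            (trans (sym (δ-rim (edge-sym G x y e) e″ e′)) (sym (cone-off x≢w z≢w)))
    ... | no x≢w | no y≢w | yes refl =
            trans (cong₂ _xor_ (trans (cone-off x≢w y≢w) (δ-rim (edge-sym G x z e″) e (edge-sym G y z e′))) (cone-right y≢w))
              (trans (solve 2 (λ a b → (a :+ b) :+ b := a) refl (h x) (h y)) (sym (cone-right x≢w)))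
    ... | no x≢w | no y≢w | no z≢w = trans (cong₂ _xor_ (cone-off x≢w y≢w) (cone-off y≢w z≢w))
            (trans (triangle c (~-⁺ G w e x≢w y≢w) (~-⁺ G w e′ y≢w z≢w) (~-⁺ G w e″ x≢w z≢w)) (sym (cone-off x≢w z≢w)))

-- The connecting map from H⁰ of the rim to H¹(G): the cone of `g` over the zero cochain is a
-- cocycle. Its potential `f` is locally constant on `G - w`, hence constant there, so on the rim
-- `g` is `f w` plus a constant.
rim-conn : ∀ {G} w → Acyclic G → Conn (G - w) → Conn (rim G w)
rim-conn {G} w acyclic conn g lc {x} {y} x∈ y∈
  with f , δ ← acyclic (cone w g λ _ _ → false) (cone-cocycle w g _ {G}
                 (record { symmetric = λ _ → refl ; triangle = λ _ _ _ → refl })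
                 (λ {x} {y} e → sym (trans (cong (_xor g y) (lc e)) (xor-same (g y)))))
  = trans (value x∈) (trans (cong (f w xor_) (conn f f-lc (off x∈) (off y∈))) (sym (value y∈)))
  where
  off : ∀ {x} → x ∈ rim G w → x ∈ G - w
  off x∈ = let w~x = ∈-rim⁻ G w x∈ in ∈-⁺ G w (neighbour G w~x) (λ eq → edge⇒≢ G w~x (sym eq))
  value : ∀ {x} → x ∈ rim G w → g x ≡ f w xor f x
  value x∈ = trans (sym (cone-left w g (λ _ _ → false))) (δ (∈-rim⁻ G w x∈))
  f-lc : LocallyConstant (G - w) f
  f-lc {x} {y} e with x~y , x≢w , y≢w ← ~-⁻ G w {x} {y} e =
    xor-cancel (f x) (f y) (trans (sym (δ x~y)) (cone-off w g (λ _ _ → false) x≢w y≢w))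

-- A cocycle on `G - w` that is trivial on the rim is the restriction of a cocycle on `G`, its cone,
-- whose potential restricts as well.
coboundary-delete : ∀ {G φ h} w → Acyclic G → Cocycle (G - w) φ → φ isCoboundaryOf h on rim G w →
                    ∃[ f ] φ isCoboundaryOf f on (G - w)
coboundary-delete {G} {φ} {h} w acyclic c δ with f , δ′ ← acyclic (cone w h φ) (cone-cocycle w h φ {G} c δ) =
  f , λ {x} {y} e → let x~y , x≢w , y≢w = ~-⁻ G w {x} {y} e in
    trans (sym (cone-off w h φ x≢w y≢w)) (δ′ x~y)

T-not⁺ : ∀ {b} → ¬ T b → T (not b)
T-not⁺ {false} _ = _
T-not⁺ {true}  p = p _

T-not⁻ : ∀ {b} → T (not b) → ¬ T b
T-not⁻ {false} _ ()

T-⇔⇒≡ : ∀ {a b} → (T a → T b) → (T b → T a) → a ≡ b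
T-⇔⇒≡ {false} {false} _ _ = refl
T-⇔⇒≡ {false} {true}  _ q = ⊥-elim (q _)
T-⇔⇒≡ {true}  {false} p _ = ⊥-elim (p _)
T-⇔⇒≡ {true}  {true}  _ _ = refl

rim⊆delete : ∀ G w {x y} → rim G w ⊢ x ~ y → G - w ⊢ x ~ y
rim⊆delete G w e = let p , q , s = ~-rim⁻ G w e in ~-⁺ G w p (λ eq → edge⇒≢ G q (sym eq)) (λ eq → edge⇒≢ G s (sym eq))

-- A connected rim gives detours around `u`: a locally constant function on `G - u` takes one value
-- on the rim and so extends to `u` by that value.
conn-delete : ∀ {G u v} → Conn G → Conn (rim G u) → G ⊢ u ~ v → Conn (G - u)
conn-delete {G} {u} {v} conn connᵣ u~v g lc {x} {y} x∈ y∈ =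
  trans (sym (off (proj₂ (∈-⁻ G u x∈))))
        (trans (conn g′ lc′ (proj₁ (∈-⁻ G u x∈)) (proj₁ (∈-⁻ G u y∈))) (off (proj₂ (∈-⁻ G u y∈))))
  where
  g′ : ℕ → Bool
  g′ = g [ u ↦ g v ]
  off : ∀ {x} → x ≢ u → g′ x ≡ g x
  off = update-off g u (g v)
  at-u : ∀ {b} → G ⊢ u ~ b → g′ u ≡ g′ b
  at-u u~b = trans (update-at g u (g v))
    (trans (connᵣ g (λ e → lc (rim⊆delete G u e)) (∈-rim⁺ G u u~v) (∈-rim⁺ G u u~b))
           (sym (off (λ eq → edge⇒≢ G u~b (sym eq)))))
  lc′ : LocallyConstant G g′
  lc′ {a} {b} a~b with a ≟ u | b ≟ u
  ... | yes refl | _ = at-u a~b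
  ... | _ | yes refl = sym (at-u (edge-sym G a b a~b))
  ... | no a≢u | no b≢u = trans (off a≢u) (trans (lc (~-⁺ G u a~b a≢u b≢u)) (sym (off b≢u)))

acyclic-delete : ∀ {G} w → Acyclic G → Contractible (rim G w) → Acyclic (G - w)
acyclic-delete {G} w acyclic rimC φ c
  with h , δ ← contractible⇒acyclic rimC φ (cocycle-⊆ {G - w} {rim G w} (rim⊆delete G w) c) =
  coboundary-delete {G} {φ} {h} w acyclic c δ

-- Finite spaces: counting points and searching for them

count : ℕ → (ℕ → Bool) → ℕ
count zero    p = 0
count (suc n) p = (if p n then 1 else 0) + count n p

module _ {p q : ℕ → Bool} (p⇒q : ∀ x → T (p x) → T (q x)) where

  private
    bit-mono : ∀ x → (if p x then 1 else 0) ≤ (if q x then 1 else 0)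
    bit-mono x with p x | q x | p⇒q x
    ... | false | _     | _ = z≤n
    ... | true  | true  | _ = ≤-refl
    ... | true  | false | f = ⊥-elim (f _)

    bit-< : ∀ x → T (q x) → ¬ T (p x) → (if p x then 1 else 0) < (if q x then 1 else 0)
    bit-< x qx ¬px with p x | q x
    ... | false | true = ≤-refl
    ... | true  | _    = ⊥-elim (¬px _)

  count-mono-≤ : ∀ n → count n p ≤ count n q
  count-mono-≤ zero    = z≤n
  count-mono-≤ (suc n) = +-mono-≤ (bit-mono n) (count-mono-≤ n)

  count-mono-< : ∀ n {x} → x < n → T (q x) → ¬ T (p x) → count n p < count n q
  count-mono-< (suc n) x<1+n qx ¬px with m<1+n⇒m<n∨m≡n x<1+n
  ... | inj₁ x<n  = +-mono-≤-< (bit-mono n) (count-mono-< n x<n qx ¬px)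
  ... | inj₂ refl = +-mono-<-≤ (bit-< n qx ¬px) (count-mono-≤ n)

Bounded : ℕ → DigitalSpace → Set
Bounded N G = ∀ x → x ∈ G → x < N

bounded-search : ∀ N {P : ℕ → Set} → Decidable P → (∀ {x} → P x → x < N) → Dec (∃ P)
bounded-search N P? bound = map′ (λ (x , _ , p) → x , p) (λ (x , p) → x , bound p , p) (anyUpTo? P? N)

~-bound : ∀ {N} G → Bounded N G → ∀ {x y} → G ⊢ x ~ y → y < N
~-bound G b e = b _ (neighbour G e)

-- If no edge left `X`, its indicator would be locally constant. Boundedness makes the search for
-- such an edge decidable, so an actual edge comes out of `Conn`.
crossing-edge : ∀ {N} G → Bounded N G → Conn G → (X : ℕ → Bool) → ∀ {x y} →
                x ∈ G → T (X x) → y ∈ G → ¬ T (X y) →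
                ∃[ u ] ∃[ v ] (G ⊢ u ~ v × T (X u) × ¬ T (X v))
crossing-edge {N} G bnd conn X {x} {y} x∈ Xx y∈ ¬Xy
  with bounded-search N
         (λ u → bounded-search N (λ v → T? (edge G u v) ×-dec T? (X u) ×-dec ¬? (T? (X v)))
                  (λ (e , _) → ~-bound G bnd e))
         (λ {u} (v , e , _) → bnd u (edge-point G u v e))
... | yes p = p
... | no ¬p = ⊥-elim (¬Xy (subst T (conn X lc x∈ y∈) Xx))
  where
  inside : ∀ {u v} → G ⊢ u ~ v → T (X u) → T (X v)
  inside {u} {v} e Xu with T? (X v)
  ... | yes Xv = Xv
  ... | no ¬Xv = ⊥-elim (¬p (u , v , e , Xu , ¬Xv))
  lc : LocallyConstant G X
  lc {u} {v} e = T-⇔⇒≡ (inside e) (inside (edge-sym G u v e))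

singleton : ℕ → ℕ → Bool
singleton u = (λ _ → false) [ u ↦ true ]

∈singleton⁻ : ∀ {u x} → T ((singleton u) x) → x ≡ u
∈singleton⁻ {u} {x} t with x ≟ u
... | yes eq = eq
... | no x≢u = ⊥-elim (subst T (update-off (λ _ → false) u true x≢u) t)

∈singleton⁺ : ∀ u → T ((singleton u) u)
∈singleton⁺ u = subst T (sym (update-at (λ _ → false) u true)) _

conn-neighbour : ∀ {N} G → Bounded N G → Conn G → ∀ {u y} → u ∈ G → y ∈ G → y ≢ u → ∃[ v ] G ⊢ u ~ v
conn-neighbour G bnd conn {u} u∈ y∈ y≢u
  with a , v , e , a∈ , _ ← crossing-edge G bnd conn (singleton u) u∈ (∈singleton⁺ u) y∈ (λ t → y≢u (∈singleton⁻ t))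
  with refl ← ∈singleton⁻ {u} {a} a∈ = v , e

bounded-delete : ∀ {N} G v → Bounded N G → Bounded N (G - v)
bounded-delete G v b x x∈ = b x (proj₁ (∈-⁻ G v x∈))

count-delete : ∀ {N} G v → Bounded N G → v ∈ G → count N (point (G - v)) < count N (point G)
count-delete {N} G v b v∈ =
  count-mono-< (λ x x∈ → proj₁ (∈-⁻ G v {x} x∈)) N (b v v∈) v∈ (λ t → proj₂ (∈-⁻ G v {v} t) refl)

-- Contractibility of paths

DegreeAtMost1 : DigitalSpace → ℕ → Set
DegreeAtMost1 G u = ∀ {a b} → G ⊢ u ~ a → G ⊢ u ~ b → a ≡ b

DegreeAtMost2 : DigitalSpace → Set
DegreeAtMost2 G = ∀ {u a b c} → G ⊢ u ~ a → G ⊢ u ~ b → G ⊢ u ~ c → a ≡ b ⊎ b ≡ c ⊎ a ≡ c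

-- Peel the path from its end `u`: the rim of `u` is its single neighbour `v`, and `v` becomes an
-- end because `u` was one of its at most two neighbours. `n` bounds the number of points left.
path-contractible : ∀ n {N} G {u} → count N (point G) < n → Bounded N G → Conn G → DegreeAtMost2 G →
                    u ∈ G → DegreeAtMost1 G u → Contractible G
path-contractible (suc n) {N} G {u} (s≤s size) bnd conn deg2 u∈ deg1
  with bounded-search N (λ y → T? (point G y) ×-dec ¬? (y ≟ u)) (λ (y∈ , _) → bnd _ y∈)
... | no none = trivial (u , u∈ , only)
  where
  only : ∀ y → y ∈ G → y ≡ u
  only y y∈ with y ≟ u
  ... | yes eq = eq
  ... | no y≢u = ⊥-elim (none (y , y∈ , y≢u))
... | yes (y , y∈ , y≢u) with v , e ← conn-neighbour G bnd conn u∈ y∈ y≢u =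
  delete u (u∈ , trivial-rim)
    (path-contractible n (G - u) (<-≤-trans (count-delete G u bnd u∈) size) (bounded-delete G u bnd)
      (conn-delete {G} conn (contractible⇒conn trivial-rim) e)
      (λ e₁ e₂ e₃ → deg2 (in-G e₁) (in-G e₂) (in-G e₃))
      (∈-⁺ G u (neighbour G e) (λ eq → edge⇒≢ G e (sym eq))) deg1′)
  where
  trivial-rim : Contractible (rim G u)
  trivial-rim = trivial (v , ∈-rim⁺ G u e , λ z z∈ → deg1 (∈-rim⁻ G u {z} z∈) e)
  in-G : ∀ {x y} → G - u ⊢ x ~ y → G ⊢ x ~ y
  in-G e = proj₁ (~-⁻ G u e)
  deg1′ : DegreeAtMost1 (G - u) v
  deg1′ v~a v~b with v~a , _ , a≢u ← ~-⁻ G u v~a | v~b , _ , b≢u ← ~-⁻ G u v~b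
    with deg2 (edge-sym G u v e) v~a v~b
  ... | inj₁ u≡a        = ⊥-elim (a≢u (sym u≡a))
  ... | inj₂ (inj₁ a≡b) = a≡b
  ... | inj₂ (inj₂ u≡b) = ⊥-elim (b≢u (sym u≡b))

0-sphere-pair : ∀ {G} → IsSphere 0 G → ∀ {a b c} → a ∈ G → b ∈ G → c ∈ G → a ≡ b ⊎ b ≡ c ⊎ a ≡ c
0-sphere-pair (x , y , _ , _ , _ , _ , only) a∈ b∈ c∈ with only _ a∈ | only _ b∈ | only _ c∈
... | inj₁ refl | inj₁ refl | _         = inj₁ refl
... | inj₂ refl | inj₂ refl | _         = inj₁ refl
... | inj₁ refl | inj₂ refl | inj₁ refl = inj₂ (inj₂ refl)
... | inj₁ refl | inj₂ refl | inj₂ refl = inj₂ (inj₁ refl)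
... | inj₂ refl | inj₁ refl | inj₁ refl = inj₂ (inj₁ refl)
... | inj₂ refl | inj₁ refl | inj₂ refl = inj₂ (inj₂ refl)

1-sphere-degree : ∀ {G} → (∀ u → u ∈ G → IsSphere 0 (rim G u)) → DegreeAtMost2 G
1-sphere-degree {G} rims {u} {a} e₁ e₂ e₃ =
  0-sphere-pair {rim G u} (rims u (edge-point G u a e₁)) (∈-rim⁺ G u e₁) (∈-rim⁺ G u e₂) (∈-rim⁺ G u e₃)

∈-induced⁻ : ∀ G X {x} → x ∈ induced G X → x ∈ G × T (X x)
∈-induced⁻ G X {x} t = T-split {point G x} t

~-induced⁻ : ∀ G X {x y} → induced G X ⊢ x ~ y → G ⊢ x ~ y × T (X x) × T (X y)
~-induced⁻ G X {x} {y} t with p , q ← T-split {edge G x y} t with r , s ← T-split {X x} q = p , r , s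

~-induced⁺ : ∀ G X {x y} → G ⊢ x ~ y → T (X x) → T (X y) → induced G X ⊢ x ~ y
~-induced⁺ G X {x} {y} p q r = T-pair {edge G x y} p (T-pair {X x} q r)

-- Grow a connected set from r, one point at a time, until a single point of B is missing.
module _ {N} (G : DigitalSpace) (bnd : Bounded N G) (conn : Conn G) {B : ℕ → Set} (B? : Decidable B)
         {r} (r∈ : r ∈ G) where

  record Exhaustion : Set where
    field
      set       : ℕ → Bool
      root      : T (set r)
      connected : Conn (induced G set)
      last      : ℕ
      last∈     : last ∈ G
      last∈B    : B last
      last∉     : ¬ T (set last)
      others    : ∀ {b} → b ∈ G → B b → b ≢ last → T (set b)

  grow : ∀ n X → count N (λ x → point G x ∧ not (X x)) < n → T (X r) → Conn (induced G X) →
         ∃[ b ] (b ∈ G × B b × ¬ T (X b)) → Exhaustion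
  grow (suc n) X (s≤s size) Xr connX (b , b∈ , Bb , ¬Xb)
    with u , v , e , Xu , ¬Xv ← crossing-edge G bnd conn X r∈ Xr b∈ ¬Xb
    with bounded-search N (λ c → T? (point G c) ×-dec B? c ×-dec ¬? (T? ((X [ v ↦ true ]) c))) (λ (c∈ , _) → bnd _ c∈)
  -- Adding `v` would absorb all of `B`, so growth stops just before. As `b` is not yet in `X`, it
  -- must be `v`, the only point of `B` still missing.
  ... | no none = record
    { set = X ; root = Xr ; connected = connX ; last = b ; last∈ = b∈ ; last∈B = Bb ; last∉ = ¬Xb
    ; others = λ {c} c∈ Bc c≢b → added (λ c≡v → c≢b (trans c≡v (sym b≡v))) (reached c∈ Bc)
    }
    where
    reached : ∀ {c} → c ∈ G → B c → T ((X [ v ↦ true ]) c)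
    reached {c} c∈ Bc with T? ((X [ v ↦ true ]) c)
    ... | yes t = t
    ... | no ¬t = ⊥-elim (none (c , c∈ , Bc , ¬t))
    added : ∀ {c} → c ≢ v → T ((X [ v ↦ true ]) c) → T (X c)
    added c≢v = subst T (update-off X v true c≢v)
    b≡v : b ≡ v
    b≡v with b ≟ v
    ... | yes eq = eq
    ... | no b≢v = ⊥-elim (¬Xb (added b≢v (reached b∈ Bb)))
  ... | yes missing = grow n X′ (<-≤-trans size′ size) (mono Xr) conn′ missing
    where
    X′ : ℕ → Bool
    X′ = X [ v ↦ true ]
    X′v : T (X′ v)
    X′v = subst T (sym (update-at X v true)) _
    mono : ∀ {x} → T (X x) → T (X′ x)
    mono {x} Xx = subst T (sym (update-off X v true λ { refl → ¬Xv Xx })) Xx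
    size′ : count N (λ x → point G x ∧ not (X′ x)) < count N (λ x → point G x ∧ not (X x))
    size′ = count-mono-<
      (λ x t → let p , q = T-split {point G x} t in T-pair {point G x} p (T-not⁺ (λ Xx → T-not⁻ q (mono Xx))))
      N (~-bound G bnd e) (T-pair {point G v} (neighbour G e) (T-not⁺ ¬Xv)) (λ t → T-not⁻ (proj₂ (T-split {point G v} t)) X′v)
    conn′ : Conn (induced G X′)
    conn′ g lc {x} {y} x∈ y∈ = trans (to-u x∈) (sym (to-u y∈))
      where
      to-u : ∀ {x} → x ∈ induced G X′ → g x ≡ g u
      to-u {x} x∈ with x ≟ v | ∈-induced⁻ G X′ {x} x∈
      ... | yes refl | _ = sym (lc (~-induced⁺ G X′ e (mono Xu) X′v))
      ... | no x≢v | x∈G , X′x =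
        connX g (λ {a} {b} e → let p , q , r = ~-induced⁻ G X {a} {b} e in lc (~-induced⁺ G X′ p (mono q) (mono r)))
          (T-pair {point G x} x∈G (subst T (update-off X v true x≢v) X′x))
          (T-pair {point G u} (edge-point G u v e) Xu)

  exhaustion : ∃[ b ] (b ∈ G × B b × b ≢ r) → Exhaustion
  exhaustion (b , b∈ , Bb , b≢r) =
    grow _ (singleton r) ≤-refl (∈singleton⁺ r)
      (λ g _ {x} {y} x∈ y∈ → cong g (trans (∈singleton⁻ (proj₂ (∈-induced⁻ G (singleton r) {x} x∈)))
                                           (sym (∈singleton⁻ (proj₂ (∈-induced⁻ G (singleton r) {y} y∈))))))
      (b , b∈ , Bb , λ t → b≢r (∈singleton⁻ t))

-- Dismantling a proper acyclic part of a surface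

-- Induced subgraphs, characterised pointwise instead of as some `induced M p`: repeated deletions
-- nest their Boolean conditions and are not literally of that form.
record _FullIn_ (G M : DigitalSpace) : Set where
  field
    sub-point : ∀ {x} → x ∈ G → x ∈ M
    sub-edge  : ∀ {x y} → G ⊢ x ~ y → M ⊢ x ~ y
    full      : ∀ {x y} → x ∈ G → y ∈ G → M ⊢ x ~ y → G ⊢ x ~ y

open _FullIn_

delete-fullIn : ∀ {G M} w → G FullIn M → (G - w) FullIn M
delete-fullIn {G} w f = record
  { sub-point = λ x∈ → sub-point f (proj₁ (∈-⁻ G w x∈))
  ; sub-edge  = λ e → sub-edge f (proj₁ (~-⁻ G w e))
  ; full      = λ x∈ y∈ e → let x∈G , x≢w = ∈-⁻ G w x∈ ; y∈G , y≢w = ∈-⁻ G w y∈ in ~-⁺ G w (full f x∈G y∈G e) x≢w y≢w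
  }

module Surface (M : DigitalSpace) (N : ℕ) (bound : Bounded N M)
  (link : ∀ v → v ∈ M → IsSphere 1 (rim M v)) (delete-conn : ∀ {v} → v ∈ M → Conn (M - v)) where

  -- Away from `w` the set `K` is a union of components of `M - w`, which is connected; missing `o`,
  -- it misses everything. This is how the global shape of `M` controls separation inside `G`.
  closed-empty : ∀ (K : ℕ → Bool) {w o x} → w ∈ M →
                 (∀ {x y} → M ⊢ x ~ y → x ≢ w → y ≢ w → T (K x) → T (K y)) →
                 o ∈ M → o ≢ w → ¬ T (K o) → x ∈ M → x ≢ w → ¬ T (K x)
  closed-empty K {w} w∈ closed o∈ o≢w ¬Ko x∈ x≢w Kx =
    ¬Ko (subst T (delete-conn w∈ K lc (∈-⁺ M w x∈ x≢w) (∈-⁺ M w o∈ o≢w)) Kx)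
    where
    lc : LocallyConstant (M - w) K
    lc {x} {y} e with x~y , x≢w , y≢w ← ~-⁻ M w {x} {y} e =
      T-⇔⇒≡ (closed x~y x≢w y≢w) (closed (edge-sym M x y x~y) y≢w x≢w)

  Boundary : DigitalSpace → ℕ → Set
  Boundary G x = ∃[ y ] (M ⊢ x ~ y × ¬ (y ∈ G))

  boundary? : ∀ G → Decidable (Boundary G)
  boundary? G x = bounded-search N (λ y → T? (edge M x y) ×-dec ¬? (T? (point G y))) (λ (e , _) → ~-bound M bound e)

  interior : ∀ {G x y} → ¬ Boundary G x → M ⊢ x ~ y → y ∈ G
  interior {G} {x} {y} ¬B e with T? (point G y)
  ... | yes y∈ = y∈
  ... | no y∉  = ⊥-elim (¬B (y , e , y∉))

  module _ {G : DigitalSpace} (f : G FullIn M) where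

    -- No edge of `M - r` leaves the rest of `G`, because its points are not boundary points. As
    -- `M - r` is connected and contains `o`, that rest is empty.
    one-boundary-point : ∀ {o r} → o ∈ M → ¬ (o ∈ G) → r ∈ G → (∀ {b} → b ∈ G → Boundary G b → b ≡ r) → Trivial G
    one-boundary-point {o} {r} o∈ o∉ r∈ only = r , r∈ , λ y y∈ → go y y∈ (y ≟ r)
      where
      go : ∀ y → y ∈ G → Dec (y ≡ r) → y ≡ r
      go y y∈ (yes eq) = eq
      go y y∈ (no y≢r) = ⊥-elim (closed-empty (point G) (sub-point f r∈)
        (λ {x} e x≢r _ x∈ → interior {G} (λ B → x≢r (only x∈ B)) e)
        o∈ (λ { refl → o∉ r∈ }) o∉ (sub-point f y∈) y≢r y∈)

    -- A component of G - w that misses r has no boundary point, so it would be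
    -- a component of M - w.
    last-point-conn : ∀ {bnd : Bounded N G} {conn : Conn G} {r} {r∈ : r ∈ G} →
                      (E : Exhaustion G bnd conn (boundary? G) r∈) → Conn (G - Exhaustion.last E)
    last-point-conn {r = r} {r∈} E g lc {x} {y} x∈ y∈ = trans (to-r x∈) (sym (to-r y∈))
      where
      open Exhaustion E renaming (last to w; set to Y)
      ≢w : ∀ {x} → T (Y x) → x ≢ w
      ≢w Yx refl = last∉ Yx
      -- The points of `G` on which `g` differs from its value at `r`. Since `g` is constant on `Y`,
      -- these avoid `Y` and, apart from `w`, contain no boundary point.
      K : ℕ → Bool
      K x = point G x ∧ (g x xor g r)
      on-Y : ∀ {x} → x ∈ G → T (Y x) → g x ≡ g r
      on-Y {x} x∈ Yx = connected g
        (λ {a} {b} e → let p , q , s = ~-induced⁻ G Y {a} {b} e in lc (~-⁺ G w p (≢w q) (≢w s)))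
        (T-pair {point G x} x∈ Yx) (T-pair {point G r} r∈ root)
      T-xor : ∀ {a b} → T (a xor b) → a ≢ b
      T-xor {true}  {true} () refl
      T-xor {false} {false} () refl
      ≢⇒T-xor : ∀ {a b} → a ≢ b → T (a xor b)
      ≢⇒T-xor {false} {false} n = ⊥-elim (n refl)
      ≢⇒T-xor {false} {true} n = _
      ≢⇒T-xor {true} {false} n = _
      ≢⇒T-xor {true} {true} n = ⊥-elim (n refl)
      closed : ∀ {x y} → M ⊢ x ~ y → x ≢ w → y ≢ w → T (K x) → T (K y)
      closed {x} {y} e x≢w y≢w Kx with x∈ , d ← T-split {point G x} Kx =
        T-pair {point G y} y∈G (subst (λ a → T (a xor g r)) (lc (~-⁺ G w (full f x∈ y∈G e) x≢w y≢w)) d)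
        where
        y∈G : y ∈ G
        y∈G = interior {G} (λ B → T-xor {g x} {g r} d (on-Y x∈ (others x∈ B x≢w))) e
      to-r : ∀ {x} → x ∈ G - w → g x ≡ g r
      to-r {x} x∈ with x∈G , x≢w ← ∈-⁻ G w x∈ with g x Bool.≟ g r
      ... | yes eq = eq
      ... | no neq = ⊥-elim (closed-empty K (sub-point f last∈) closed (sub-point f r∈) (≢w root)
              (λ Kr → T-xor {g r} {g r} (proj₂ (T-split {point G r} Kr)) refl)
              (sub-point f x∈G) x≢w (T-pair {point G x} x∈G (≢⇒T-xor neq)))

    -- The rim of `w` in `M` is a cycle that contains `s` in `G` and `t` outside, so some edge of it
    -- leads from a point `u` of `G` to a point `u′` outside. Having lost `u′`, `u` is an end of the
    -- rim in `G`, which is therefore a path.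
    rim-contractible : ∀ {w s} → w ∈ G → Boundary G w → G ⊢ w ~ s → Conn (rim G w) → Contractible (rim G w)
    rim-contractible {w} {s} w∈ (t , w~t , t∉) w~s conn
      with u , u′ , e , u∈ , u′∉ ← crossing-edge (rim M w) (λ x x∈ → ~-bound M bound (∈-rim⁻ M w {x} x∈))
             (Connected⇒Conn {rim M w} (proj₁ (link w (sub-point f w∈)))) (point G)
             (∈-rim⁺ M w (sub-edge f w~s)) (neighbour G w~s) (∈-rim⁺ M w w~t) t∉
      = path-contractible _ (rim G w) {u} ≤-refl (λ x x∈ → bound x (neighbour M (sub-edge f (∈-rim⁻ G w {x} x∈))))
          conn (λ e₁ e₂ e₃ → deg2 (rim-M e₁) (rim-M e₂) (rim-M e₃))
          (∈-rim⁺ G w (full f w∈ u∈ (∈-rim⁻ M w (edge-point (rim M w) u u′ e)))) deg1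
      where
      deg2 : DegreeAtMost2 (rim M w)
      deg2 = 1-sphere-degree {rim M w} (λ u u∈ → proj₁ (proj₂ (link w (sub-point f w∈)) u u∈))
      rim-M : ∀ {x y} → rim G w ⊢ x ~ y → rim M w ⊢ x ~ y
      rim-M e = let p , q , r = ~-rim⁻ G w e in ~-rim⁺ M w (sub-edge f p) (sub-edge f q) (sub-edge f r)
      u′-off : ∀ {a} → rim G w ⊢ u ~ a → u′ ≢ a
      u′-off e refl = u′∉ (neighbour G (proj₁ (~-rim⁻ G w {u} e)))
      deg1 : DegreeAtMost1 (rim G w) u
      deg1 e₁ e₂ with deg2 e (rim-M e₁) (rim-M e₂)
      ... | inj₁ u′≡a        = ⊥-elim (u′-off e₁ u′≡a)
      ... | inj₂ (inj₁ a≡b)  = a≡b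
      ... | inj₂ (inj₂ u′≡b) = ⊥-elim (u′-off e₂ u′≡b)

  -- `o` witnesses that `G` stays proper. `r` is the root from which connected sets grow; it is
  -- never deleted and is the point left at the end.
  dismantle : ∀ n {G} → count N (point G) < n → G FullIn M → Conn G → Acyclic G →
              ∀ {o r} → o ∈ M → ¬ (o ∈ G) → r ∈ G → Contractible G
  dismantle (suc n) {G} (s≤s size) f conn acyclic {o} {r} o∈ o∉ r∈
    with bounded-search N (λ b → T? (point G b) ×-dec boundary? G b ×-dec ¬? (b ≟ r)) (λ (b∈ , _) → bound _ (sub-point f b∈))
  ... | no none = trivial (one-boundary-point f o∈ o∉ r∈ only)
    where
    only : ∀ {b} → b ∈ G → Boundary G b → b ≡ r
    only {b} b∈ B with b ≟ r
    ... | yes eq = eq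
    ... | no b≢r = ⊥-elim (none (b , b∈ , B , b≢r))
  ... | yes another = remove-last (exhaustion G bnd conn (boundary? G) r∈ another)
    where
    bnd : Bounded N G
    bnd x x∈ = bound x (sub-point f x∈)
    remove-last : Exhaustion G bnd conn (boundary? G) r∈ → Contractible G
    remove-last E = delete w (last∈ , rim-w)
      (dismantle n (<-≤-trans (count-delete G w bnd last∈) size) (delete-fullIn w f) conn-w
        (acyclic-delete {G} w acyclic rim-w)
        o∈ (λ o∈ → o∉ (proj₁ (∈-⁻ G w o∈))) (∈-⁺ G w r∈ r≢w))
      where
      open Exhaustion E renaming (last to w)
      r≢w : r ≢ w
      r≢w r≡w = last∉ (subst (λ x → T (set x)) r≡w root)
      conn-w : Conn (G - w)
      conn-w = last-point-conn f E
      rim-w : Contractible (rim G w)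
      rim-w = rim-contractible f last∈ last∈B (proj₂ (conn-neighbour G bnd conn last∈ r∈ r≢w))
                (rim-conn {G} w acyclic conn-w)

-- Sums over the field of two elements

open Summation (CommutativeRing.semiring xor-∧-commutativeRing)
  using (sum; sum-cong-≗; ∑-distrib-+; ∑-comm; *-distribˡ-sum)

∑ : ℕ → (ℕ → Bool) → Bool
∑ n f = sum {n} (λ i → f (toℕ i))

∑-cong : ∀ n {f g} → (∀ x → f x ≡ g x) → ∑ n f ≡ ∑ n g
∑-cong n f≗g = sum-cong-≗ {n} (λ i → f≗g (toℕ i))

∑-zero : ∀ n {f} → (∀ x → f x ≡ false) → ∑ n f ≡ false
∑-zero zero    f≡0 = refl
∑-zero (suc n) f≡0 = cong₂ _xor_ (f≡0 0) (∑-zero n (λ x → f≡0 (suc x)))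

∑-xor : ∀ n f g → ∑ n (λ x → f x xor g x) ≡ ∑ n f xor ∑ n g
∑-xor n f g = ∑-distrib-+ {n} (λ i → f (toℕ i)) (λ i → g (toℕ i))

∑-swap : ∀ n (f : ℕ → ℕ → Bool) → ∑ n (λ x → ∑ n (λ y → f x y)) ≡ ∑ n (λ y → ∑ n (λ x → f x y))
∑-swap n f = ∑-comm {n} {n} (λ i j → f (toℕ i) (toℕ j))

∑-single : ∀ n {f a} → a < n → (∀ {x} → x ≢ a → f x ≡ false) → ∑ n f ≡ f a
∑-single (suc n) {f} {zero} _ off =
  trans (cong (f 0 xor_) (∑-zero n {λ x → f (suc x)} (λ x → off (λ ())))) (xor-identityʳ (f 0))
∑-single (suc n) {f} {suc a} (s≤s a<n) off =
  cong₂ _xor_ (off (λ ())) (∑-single n {λ x → f (suc x)} a<n (λ x≢a → off (λ { refl → x≢a refl })))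

∑-pair : ∀ n {f a b} → a < n → b < n → a ≢ b → (∀ {x} → x ≢ a → x ≢ b → f x ≡ false) → ∑ n f ≡ f a xor f b
∑-pair (suc n) {f} {zero} {zero} _ _ a≢b _ = ⊥-elim (a≢b refl)
∑-pair (suc n) {f} {zero} {suc b} _ (s≤s b<n) _ off =
  cong (f 0 xor_) (∑-single n {λ x → f (suc x)} b<n (λ x≢b → off (λ ()) (λ { refl → x≢b refl })))
∑-pair (suc n) {f} {suc a} {zero} (s≤s a<n) _ _ off =
  trans (cong (f 0 xor_) (∑-single n {λ x → f (suc x)} a<n (λ x≢a → off (λ { refl → x≢a refl }) (λ ())))) (xor-comm (f 0) _)
∑-pair (suc n) {f} {suc a} {suc b} (s≤s a<n) (s≤s b<n) a≢b off =
  cong₂ _xor_ (off (λ ()) (λ ())) (∑-pair n {λ x → f (suc x)} a<n b<n (λ { refl → a≢b refl })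
    (λ x≢a x≢b → off (λ { refl → x≢a refl }) (λ { refl → x≢b refl })))

-- Entries mirrored in the diagonal cancel in pairs modulo 2.
∑∑-symmetric : ∀ n {g : ℕ → ℕ → Bool} → (∀ x y → g x y ≡ g y x) → (∀ x → g x x ≡ false) →
               ∑ n (λ x → ∑ n (g x)) ≡ false
∑∑-symmetric zero    _ _ = refl
∑∑-symmetric (suc n) {g} sy diag = begin
  (g 0 0 xor ∑ n (λ y → g 0 (suc y))) xor ∑ n (λ x → g (suc x) 0 xor ∑ n (λ y → g (suc x) (suc y)))
    ≡⟨ cong₂ _xor_ (cong (_xor row) (diag 0)) (∑-xor n (λ x → g (suc x) 0) (λ x → ∑ n (λ y → g (suc x) (suc y)))) ⟩
  row xor (∑ n (λ x → g (suc x) 0) xor ∑ n (λ x → ∑ n (λ y → g (suc x) (suc y))))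
    ≡⟨ cong (row xor_) (cong₂ _xor_ (∑-cong n (λ x → sy (suc x) 0))
                                  (∑∑-symmetric n (λ x y → sy (suc x) (suc y)) (λ x → diag (suc x)))) ⟩
  row xor (row xor false)
    ≡⟨ cong (row xor_) (xor-identityʳ row) ⟩
  row xor row
    ≡⟨ xor-same row ⟩
  false ∎
  where
  open ≡-Reasoning
  row : Bool
  row = ∑ n (λ y → g 0 (suc y))

∑³ : ℕ → (ℕ → ℕ → ℕ → Bool) → Bool
∑³ n F = ∑ n (λ x → ∑ n (λ y → ∑ n (λ z → F x y z)))

∑³-rotate : ∀ n F → ∑³ n F ≡ ∑³ n (λ x y z → F y z x)
∑³-rotate n F =
  trans (∑-cong n {λ x → ∑ n (λ y → ∑ n (F x y))} {λ x → ∑ n (λ z → ∑ n (λ y → F x y z))} (λ x → ∑-swap n (F x)))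
        (∑-swap n (λ x z → ∑ n (λ y → F x y z)))

∑³-xor : ∀ n F G → ∑³ n (λ x y z → F x y z xor G x y z) ≡ ∑³ n F xor ∑³ n G
∑³-xor n F G =
  trans (∑-cong n (λ x → trans (∑-cong n (λ y → ∑-xor n (F x y) (G x y)))
                               (∑-xor n (λ y → ∑ n (F x y)) (λ y → ∑ n (G x y)))))
        (∑-xor n (λ x → ∑ n (λ y → ∑ n (F x y))) (λ x → ∑ n (λ y → ∑ n (G x y))))

<ᵇ-total : ∀ x y → x ≢ y → (x <ᵇ y) xor (y <ᵇ x) ≡ true
<ᵇ-total zero    zero    x≢y = ⊥-elim (x≢y refl)
<ᵇ-total zero    (suc y) x≢y = refl
<ᵇ-total (suc x) zero    x≢y = refl
<ᵇ-total (suc x) (suc y) x≢y = <ᵇ-total x y (λ { refl → x≢y refl })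

T⇒≡true : ∀ {b} → T b → b ≡ true
T⇒≡true = Equivalence.to T-≡

¬T⇒≡false : ∀ {b} → ¬ T b → b ≡ false
¬T⇒≡false {false} _ = refl
¬T⇒≡false {true}  n = ⊥-elim (n _)

edge-comm : ∀ G x y → edge G x y ≡ edge G y x
edge-comm G x y = T-⇔⇒≡ (edge-sym G x y) (edge-sym G y x)

-- Stokes' theorem modulo 2. The factor x <ᵇ y counts each edge once; over an
-- ordered triple, the cyclic sum of φ-counted edges and its mirror image
-- add up to the coboundary of φ.
module _ (G : DigitalSpace) {φ : ℕ → ℕ → Bool} (c : Cocycle G φ) where

  triangleᵇ : ℕ → ℕ → ℕ → Bool
  triangleᵇ x y z = edge G x y ∧ (edge G y z ∧ edge G z x)

  once : ℕ → ℕ → Bool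
  once x y = φ x y ∧ (x <ᵇ y)

  once-both : ∀ {x y} → G ⊢ x ~ y → once x y xor once y x ≡ φ x y
  once-both {x} {y} e = begin
    (φ x y ∧ (x <ᵇ y)) xor (φ y x ∧ (y <ᵇ x))
      ≡⟨ cong (λ b → (φ x y ∧ (x <ᵇ y)) xor (b ∧ (y <ᵇ x))) (symmetric c (edge-sym G x y e)) ⟩
    (φ x y ∧ (x <ᵇ y)) xor (φ x y ∧ (y <ᵇ x))
      ≡⟨ solve 3 (λ a p q → (a :* p) :+ (a :* q) := a :* (p :+ q)) refl (φ x y) (x <ᵇ y) (y <ᵇ x) ⟩
    φ x y ∧ ((x <ᵇ y) xor (y <ᵇ x))
      ≡⟨ cong (φ x y ∧_) (<ᵇ-total x y (edge⇒≢ G e)) ⟩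
    φ x y ∧ true
      ≡⟨ ∧-identityʳ (φ x y) ⟩
    φ x y ∎
    where open ≡-Reasoning

  private
    F : ℕ → ℕ → ℕ → Bool
    F x y z = triangleᵇ x y z ∧ once x y

    cyclic : ℕ → ℕ → ℕ → Bool
    cyclic x y z = F x y z xor (F y z x xor F z x y)

    cyclic-factor : ∀ x y z → cyclic x y z ≡ triangleᵇ x y z ∧ (once x y xor (once y z xor once z x))
    cyclic-factor x y z = solve 6 (λ a b d p q r →
        ((a :* (b :* d)) :* p) :+ (((b :* (d :* a)) :* q) :+ ((d :* (a :* b)) :* r)) := (a :* (b :* d)) :* (p :+ (q :+ r)))
      refl (edge G x y) (edge G y z) (edge G z x) (once x y) (once y z) (once z x)

    cyclic-diagonal : ∀ x z → cyclic x x z ≡ false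
    cyclic-diagonal x z = trans (cyclic-factor x x z)
      (cong (λ b → (b ∧ (edge G x z ∧ edge G z x)) ∧ (once x x xor (once x z xor once z x))) (¬T⇒≡false (edge-irrefl G x)))

    mirror : ∀ x y z → triangleᵇ x y z ≡ triangleᵇ y x z
    mirror x y z = trans (cong₂ _∧_ (edge-comm G x y) (cong₂ _∧_ (edge-comm G y z) (edge-comm G z x)))
      (solve 3 (λ a b d → a :* (b :* d) := a :* (d :* b)) refl (edge G y x) (edge G z y) (edge G x z))

    cyclic-symmetric : ∀ x y z → cyclic x y z ≡ cyclic y x z
    cyclic-symmetric x y z = trans (cyclic-factor x y z) (trans flip (sym (cyclic-factor y x z)))
      where
      flip : triangleᵇ x y z ∧ (once x y xor (once y z xor once z x)) ≡
             triangleᵇ y x z ∧ (once y x xor (once x z xor once z y))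
      flip with T? (triangleᵇ x y z)
      ... | no ¬t = trans (cong (_∧ _) (¬T⇒≡false ¬t)) (sym (cong (_∧ _) (trans (sym (mirror x y z)) (¬T⇒≡false ¬t))))
      ... | yes t with x~y , r ← T-split {edge G x y} t with y~z , z~x ← T-split {edge G y z} r =
        cong₂ _∧_ (mirror x y z) (xor-cancel _ _ (begin
          (once x y xor (once y z xor once z x)) xor (once y x xor (once x z xor once z y))
            ≡⟨ solve 6 (λ a b d p q r → (a :+ (b :+ d)) :+ (p :+ (q :+ r)) := ((a :+ p) :+ (b :+ r)) :+ (q :+ d)) refl
                 (once x y) (once y z) (once z x) (once y x) (once x z) (once z y) ⟩
          ((once x y xor once y x) xor (once y z xor once z y)) xor (once x z xor once z x)
            ≡⟨ cong₂ _xor_ (cong₂ _xor_ (once-both x~y) (once-both y~z)) (once-both x~z) ⟩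
          (φ x y xor φ y z) xor φ x z
            ≡⟨ cong (_xor φ x z) (triangle c x~y y~z x~z) ⟩
          φ x z xor φ x z
            ≡⟨ xor-same (φ x z) ⟩
          false ∎))
        where
        open ≡-Reasoning
        x~z : G ⊢ x ~ z
        x~z = edge-sym G z x z~x

  ∑³-triangles : ∀ n → ∑³ n (λ x y z → triangleᵇ x y z ∧ once x y) ≡ false
  ∑³-triangles n = begin
    ∑³ n F
      -- Modulo 2 three copies of a sum equal one; rotating the variables in two of them makes the
      -- summand cyclic. It is then symmetric in `x` and `y` with zero diagonal, so it cancels for
      -- each fixed `z`.
      ≡⟨ solve 1 (λ a → a := a :+ (a :+ a)) refl (∑³ n F) ⟩
    ∑³ n F xor (∑³ n F xor ∑³ n F)
      ≡⟨ cong (∑³ n F xor_) (cong₂ _xor_ (∑³-rotate n F) (trans (∑³-rotate n F) (∑³-rotate n (λ x y z → F y z x)))) ⟩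
    ∑³ n F xor (∑³ n (λ x y z → F y z x) xor ∑³ n (λ x y z → F z x y))
      ≡⟨ cong (∑³ n F xor_) (sym (∑³-xor n (λ x y z → F y z x) (λ x y z → F z x y))) ⟩
    ∑³ n F xor ∑³ n (λ x y z → F y z x xor F z x y)
      ≡⟨ sym (∑³-xor n F (λ x y z → F y z x xor F z x y)) ⟩
    ∑³ n cyclic
      ≡⟨ ∑³-rotate n cyclic ⟩
    ∑ n (λ z → ∑ n (λ x → ∑ n (λ y → cyclic x y z)))
      ≡⟨ ∑-zero n (λ z → ∑∑-symmetric n (λ x y → cyclic-symmetric x y z) (λ x → cyclic-diagonal x z)) ⟩
    false ∎
    where open ≡-Reasoning

-- Cocycles on a surface with one point deleted

module PuncturedSurface (M : DigitalSpace) (N : ℕ) (bound : Bounded N M)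
  (link : ∀ v → v ∈ M → IsSphere 1 (rim M v)) where

  module _ {v : ℕ} where

    private
      e : ℕ → ℕ → Bool
      e = edge (M - v)

    -- An edge lies in two triangles of M, one of which may contain v.
    triangles-at-edge : ∀ {x y} → M - v ⊢ x ~ y → ∑ N (λ z → e y z ∧ e z x) ≡ edge M v x ∧ edge M v y
    triangles-at-edge {x} {y} x~′y with x~y , x≢v , y≢v ← ~-⁻ M v {x} {y} x~′y
      -- The third vertices `r` and `s` of the two triangles are the points of the 0-sphere
      -- `rim (rim M x) y`.
      with r , s , r∈ , s∈ , r≢s , _ , only ← proj₁ (proj₂ (link x (edge-point M x y x~y)) y (∈-rim⁺ M x x~y))
      = by-cases (r ≟ v) (s ≟ v)
      where
      common : ∀ {z} → z ∈ rim (rim M x) y → M ⊢ y ~ z × M ⊢ x ~ z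
      common {z} z∈ = let p , _ , q = ~-rim⁻ M x {y} {z} (∈-rim⁻ (rim M x) y {z} z∈) in p , q
      count-true : ∀ {z} → z ∈ rim (rim M x) y → z ≢ v → e y z ∧ e z x ≡ true
      count-true {z} z∈ z≢v with y~z , x~z ← common {z} z∈ =
        T⇒≡true (T-pair {e y z} (~-⁺ M v y~z y≢v z≢v) (~-⁺ M v (edge-sym M x z x~z) z≢v x≢v))
      count-v : e y v ∧ e v x ≡ false
      count-v = ¬T⇒≡false (λ t → proj₂ (proj₂ (~-⁻ M v {y} {v} (proj₁ (T-split {e y v} t)))) refl)
      outside : ∀ {z} → z ≢ r → z ≢ s → e y z ∧ e z x ≡ false
      outside {z} z≢r z≢s = ¬T⇒≡false λ t →
        let p , q = T-split {e y z} t
            y~z = proj₁ (~-⁻ M v {y} {z} p)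
            x~z = edge-sym M z x (proj₁ (~-⁻ M v {z} {x} q))
        in impossible (only z (∈-rim⁺ (rim M x) y (~-rim⁺ M x y~z x~y x~z)))
        where
        impossible : z ≡ r ⊎ z ≡ s → ⊥
        impossible (inj₁ eq) = z≢r eq
        impossible (inj₂ eq) = z≢s eq
      in-bound : ∀ {z} → z ∈ rim (rim M x) y → z < N
      in-bound {z} z∈ = ~-bound M bound (proj₁ (common {z} z∈))
      total : ∑ N (λ z → e y z ∧ e z x) ≡ (e y r ∧ e r x) xor (e y s ∧ e s x)
      total = ∑-pair N {λ z → e y z ∧ e z x} (in-bound {r} r∈) (in-bound {s} s∈) r≢s outside
      v-common : v ∈ rim (rim M x) y → edge M v x ∧ edge M v y ≡ true
      v-common v∈ with y~v , x~v ← common {v} v∈ = T⇒≡true (T-pair {edge M v x} (edge-sym M x v x~v) (edge-sym M y v y~v))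
      by-cases : Dec (r ≡ v) → Dec (s ≡ v) → ∑ N (λ z → e y z ∧ e z x) ≡ edge M v x ∧ edge M v y
      by-cases (yes refl) (yes refl) = ⊥-elim (r≢s refl)
      by-cases (yes refl) (no s≢v) = trans total (trans (cong₂ _xor_ count-v (count-true {s} s∈ s≢v)) (sym (v-common r∈)))
      by-cases (no r≢v) (yes refl) = trans total (trans (cong₂ _xor_ (count-true {r} r∈ r≢v) count-v) (sym (v-common s∈)))
      by-cases (no r≢v) (no s≢v) =
        trans total (trans (cong₂ _xor_ (count-true {r} r∈ r≢v) (count-true {s} s∈ s≢v)) (sym (¬T⇒≡false not-common)))
        where
        not-common : ¬ T (edge M v x ∧ edge M v y)
        not-common t with v~x , v~y ← T-split {edge M v x} t
          with only v (∈-rim⁺ (rim M x) y (~-rim⁺ M x (edge-sym M v y v~y) x~y (edge-sym M v x v~x)))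
        ... | inj₁ v≡r = r≢v (sym v≡r)
        ... | inj₂ v≡s = s≢v (sym v≡s)

    -- In the vanishing sum of `φ` over all triangles of `M - v`, an edge survives only if it lies
    -- in an odd number of them, that is, if it is an edge of the rim of `v`. If `φ` vanishes on all
    -- rim edges but one, it vanishes on that one too.
    boundary-edge : ∀ {φ a b} → Cocycle (M - v) φ → rim M v ⊢ a ~ b →
      (∀ {x y} → rim M v ⊢ x ~ y → (x ≡ a × y ≡ b) ⊎ (x ≡ b × y ≡ a) ⊎ φ x y ≡ false) → φ a b ≡ false
    boundary-edge {φ} {a} {b} c a~b others = begin
      φ a b                       ≡⟨ sym (once-both (M - v) c (rim⊆delete M v a~b)) ⟩
      once′ a b xor once′ b a     ≡⟨ sym (cong₂ _xor_ (H-rim a~b) (H-rim b~a)) ⟩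
      H a b xor H b a             ≡⟨ sym (cong₂ _xor_ row-a row-b) ⟩
      ∑ N (H a) xor ∑ N (H b)     ≡⟨ sym (∑-pair N {λ x → ∑ N (H x)} a<N b<N a≢b row-other) ⟩
      ∑ N (λ x → ∑ N (H x))       ≡⟨ sym (∑-cong N (λ x → ∑-cong N (λ y → inner x y))) ⟩
      ∑³ N (λ x y z → triangleᵇ (M - v) c x y z ∧ once′ x y) ≡⟨ ∑³-triangles (M - v) c N ⟩
      false ∎
      where
      open ≡-Reasoning
      once′ : ℕ → ℕ → Bool
      once′ = once (M - v) c
      b~a : rim M v ⊢ b ~ a
      b~a = edge-sym (rim M v) a b a~b
      -- The triangle sum after summation over the third vertex: the parity of triangles at an edge
      -- is the indicator of the rim.
      H : ℕ → ℕ → Bool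
      H x y = (e x y ∧ once′ x y) ∧ (edge M v x ∧ edge M v y)
      a≢b : a ≢ b
      a≢b = edge⇒≢ (rim M v) a~b
      a<N : a < N
      a<N = ~-bound M bound (proj₁ (proj₂ (~-rim⁻ M v {a} {b} a~b)))
      b<N : b < N
      b<N = ~-bound M bound (proj₂ (proj₂ (~-rim⁻ M v {a} {b} a~b)))
      inner : ∀ x y → ∑ N (λ z → triangleᵇ (M - v) c x y z ∧ once′ x y) ≡ H x y
      inner x y = trans
        (∑-cong N (λ z → solve 4 (λ p q s t → (p :* (q :* s)) :* t := (p :* t) :* (q :* s)) refl
                           (e x y) (e y z) (e z x) (once′ x y)))
        (trans (sym (*-distribˡ-sum {N} (e x y ∧ once′ x y) (λ i → e y (toℕ i) ∧ e (toℕ i) x))) factor)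
        where
        factor : (e x y ∧ once′ x y) ∧ ∑ N (λ z → e y z ∧ e z x) ≡ H x y
        factor with T? (e x y)
        ... | yes x~y = cong ((e x y ∧ once′ x y) ∧_) (triangles-at-edge x~y)
        ... | no ¬x~y = trans (cong (λ p → (p ∧ once′ x y) ∧ ∑ N (λ z → e y z ∧ e z x)) (¬T⇒≡false ¬x~y))
                              (sym (cong (λ p → (p ∧ once′ x y) ∧ (edge M v x ∧ edge M v y)) (¬T⇒≡false ¬x~y)))
      H-rim : ∀ {x y} → rim M v ⊢ x ~ y → H x y ≡ once′ x y
      H-rim {x} {y} x~y with _ , v~x , v~y ← ~-rim⁻ M v {x} {y} x~y =
        trans (cong₂ (λ p q → (p ∧ once′ x y) ∧ q) (T⇒≡true (rim⊆delete M v x~y))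
                (T⇒≡true (T-pair {edge M v x} v~x v~y)))
              (∧-identityʳ (once′ x y))
      vanish : ∀ {x y} → ¬ (x ≡ a × y ≡ b) → ¬ (x ≡ b × y ≡ a) → H x y ≡ false
      vanish {x} {y} ¬ab ¬ba = ¬T⇒≡false off
        where
        off : ¬ T (H x y)
        off t with p , q ← T-split {e x y ∧ once′ x y} t
          with x~y , o ← T-split {e x y} p | v~x , v~y ← T-split {edge M v x} q
          with others (~-rim⁺ M v (proj₁ (~-⁻ M v {x} {y} x~y)) v~x v~y)
        ... | inj₁ ab = ¬ab ab
        ... | inj₂ (inj₁ ba) = ¬ba ba
        ... | inj₂ (inj₂ φ≡0) = subst T φ≡0 (proj₁ (T-split {φ x y} o))
      row-a : ∑ N (H a) ≡ H a b
      row-a = ∑-single N {H a} b<N (λ y≢b → vanish (λ ab → y≢b (proj₂ ab)) (λ ba → a≢b (proj₁ ba)))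
      row-b : ∑ N (H b) ≡ H b a
      row-b = ∑-single N {H b} a<N (λ y≢a → vanish (λ ab → a≢b (sym (proj₁ ab))) (λ ba → y≢a (proj₂ ba)))
      row-other : ∀ {x} → x ≢ a → x ≢ b → ∑ N (H x) ≡ false
      row-other {x} x≢a x≢b = ∑-zero N {H x} (λ y → vanish {x} {y} (λ ab → x≢a (proj₁ ab)) (λ ba → x≢b (proj₁ ba)))

    -- Without `x` the rim is contractible, so `φ` has a potential `h` there. Its value at `x` is
    -- set to fit the edge to `y`; the defect `ψ` is then a cocycle on `M - v` that can be nonzero
    -- only on the remaining rim edge, from `x` to `z`, and `boundary-edge` removes it.
    rim-coboundary : ∀ {φ} → v ∈ M → Cocycle (M - v) φ → ∃[ h ] φ isCoboundaryOf h on rim M v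
    rim-coboundary {φ} v∈ c
      with ((x , x∈) , _) , sphere ← link v v∈
      with (y , z , y∈ , z∈ , y≢z , _ , only) , contractible ← sphere x x∈
      with h , δ ← contractible⇒acyclic contractible φ
                     (cocycle-⊆ {M - v} {rim M v - x} (λ e → rim⊆delete M v (proj₁ (~-⁻ (rim M v) x e))) c) =
      h′ , λ {a} {b} a~b → xor-cancel (φ a b) (h′ a xor h′ b) (ψ-vanishes a~b)
      where
      O = rim M v
      x~y : O ⊢ x ~ y
      x~y = ∈-rim⁻ O x {y} y∈
      x~z : O ⊢ x ~ z
      x~z = ∈-rim⁻ O x {z} z∈
      h′ : ℕ → Bool
      h′ = h [ x ↦ φ x y xor h y ]
      ψ : ℕ → ℕ → Bool
      ψ a b = φ a b xor (h′ a xor h′ b)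
      ψ-cocycle : Cocycle (M - v) ψ
      ψ-cocycle = cocycle-xor c (coboundary-cocycle {M - v} {λ a b → h′ a xor h′ b} {h′} (λ _ → refl))
      ψ-xy : ψ x y ≡ false
      ψ-xy = trans (cong (φ x y xor_) (cong₂ _xor_ (update-at h x (φ x y xor h y))
                      (update-off h x (φ x y xor h y) (λ eq → edge⇒≢ O x~y (sym eq)))))
        (solve 2 (λ a b → a :+ ((a :+ b) :+ b) := con false) refl (φ x y) (h y))
      ψ-sym : ∀ {a b} → O ⊢ a ~ b → ψ a b ≡ ψ b a
      ψ-sym a~b = symmetric ψ-cocycle (rim⊆delete M v a~b)
      ψ-off : ∀ {a b} → O ⊢ a ~ b → a ≢ x → b ≢ x → ψ a b ≡ false
      ψ-off {a} {b} a~b a≢x b≢x =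
        trans (cong₂ _xor_ (δ (~-⁺ O x a~b a≢x b≢x)) (cong₂ _xor_
                (update-off h x (φ x y xor h y) a≢x) (update-off h x (φ x y xor h y) b≢x)))
              (xor-same (h a xor h b))
      others : ∀ {a b} → O ⊢ a ~ b → (a ≡ x × b ≡ z) ⊎ (a ≡ z × b ≡ x) ⊎ ψ a b ≡ false
      others {a} {b} a~b with a ≟ x | b ≟ x
      ... | no a≢x | no b≢x = inj₂ (inj₂ (ψ-off a~b a≢x b≢x))
      ... | yes refl | _ with only b (∈-rim⁺ O x a~b)
      ...   | inj₁ refl = inj₂ (inj₂ ψ-xy)
      ...   | inj₂ b≡z  = inj₁ (refl , b≡z)
      others {a} {b} a~b | no _ | yes refl with only a (∈-rim⁺ O x (edge-sym O a x a~b))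
      ...   | inj₁ refl = inj₂ (inj₂ (trans (ψ-sym a~b) ψ-xy))
      ...   | inj₂ a≡z  = inj₂ (inj₁ (a≡z , refl))
      ψ-xz : ψ x z ≡ false
      ψ-xz = boundary-edge ψ-cocycle x~z others
      ψ-vanishes : ∀ {a b} → O ⊢ a ~ b → ψ a b ≡ false
      ψ-vanishes a~b with others a~b
      ... | inj₁ (refl , refl)        = ψ-xz
      ... | inj₂ (inj₁ (refl , refl)) = trans (ψ-sym a~b) ψ-xz
      ... | inj₂ (inj₂ ψ≡0)           = ψ≡0

    punctured-acyclic : v ∈ M → Acyclic M → Acyclic (M - v)
    punctured-acyclic v∈ acyclic φ c with h , δ ← rim-coboundary v∈ c = coboundary-delete {M} {φ} {h} v acyclic c δ

Unique-resp-↭ : ∀ {l m : List ℕ} → l ↭ m → Unique l → Unique m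
Unique-resp-↭ p = Permutation.Unique-resp-↭ (setoid ℕ) (↭⇒↭ₛ p)

Unique-++⁻ˡ : ∀ (l : List ℕ) {m} → Unique (l ++ m) → Unique l
Unique-++⁻ˡ []      _        = []
Unique-++⁻ˡ (x ∷ l) (p ∷ ps) = ++⁻ˡ l p ∷ Unique-++⁻ˡ l ps

Unique-++⁻ʳ : ∀ (l : List ℕ) {m} → Unique (l ++ m) → Unique m
Unique-++⁻ʳ []      u        = u
Unique-++⁻ʳ (x ∷ l) (_ ∷ ps) = Unique-++⁻ʳ l ps

Unique-head : ∀ {x : ℕ} {l} → Unique (x ∷ l) → x ∉ˡ l
Unique-head (p ∷ _) = All¬⇒¬Any p

-- Paths and cycles as lists of points

data Link (a b : ℕ) : List ℕ → Set where
  here  : ∀ {l} → Link a b (a ∷ b ∷ l)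
  there : ∀ {c l} → Link a b l → Link a b (c ∷ l)

link? : ∀ a b l → Dec (Link a b l)
link? a b []      = no λ ()
link? a b (c ∷ []) = no λ { (there ()) }
link? a b (c ∷ d ∷ l) with c ≟ a | d ≟ b | link? a b (d ∷ l)
... | yes refl | yes refl | _     = yes here
... | _        | _        | yes k = yes (there k)
... | no c≢a   | _        | no ¬k = no λ { here → c≢a refl ; (there k) → ¬k k }
... | yes _    | no d≢b   | no ¬k = no λ { here → d≢b refl ; (there k) → ¬k k }

link-source : ∀ {a b c} l → Link a b (l ++ c ∷ []) → a ∈ˡ l
link-source []          (there ())
link-source (x ∷ [])    here      = here refl
link-source (x ∷ y ∷ l) here      = here refl
link-source (x ∷ l)     (there k) = there (link-source l k)

link-target : ∀ {a b c l} → Link a b (c ∷ l) → b ∈ˡ l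
link-target here               = here refl
link-target (there {l = _ ∷ _} k) = there (link-target k)

link-successor : ∀ {a c} l → a ∈ˡ l → ∃[ b ] Link a b (l ++ c ∷ [])
link-successor (a ∷ [])     (here refl) = _ , here
link-successor (a ∷ b ∷ l)  (here refl) = b , here
link-successor (x ∷ l)      (there p) with b , k ← link-successor l p = b , there k

link-split : ∀ {a b c} l {m} → Link a b (l ++ c ∷ m) → Link a b (l ++ c ∷ []) ⊎ Link a b (c ∷ m)
link-split []          k    = inj₂ k
link-split (x ∷ [])    here = inj₁ here
link-split (x ∷ y ∷ l) here = inj₁ here
link-split (x ∷ l) (there k) with link-split l k
... | inj₁ k′ = inj₁ (there k′)
... | inj₂ k′ = inj₂ k′

link-++ˡ : ∀ {a b c} l {m} → Link a b (l ++ c ∷ []) → Link a b (l ++ c ∷ m)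
link-++ˡ []          (there ())
link-++ˡ (x ∷ [])    here      = here
link-++ˡ (x ∷ y ∷ l) here      = here
link-++ˡ (x ∷ l)     (there k) = there (link-++ˡ l k)

link-++ʳ : ∀ {a b} l {m} → Link a b m → Link a b (l ++ m)
link-++ʳ []      k = k
link-++ʳ (x ∷ l) k = there (link-++ʳ l k)

link-weaken : ∀ {a b l m} → Link a b l → Link a b (l ++ m)
link-weaken here      = here
link-weaken (there k) = there (link-weaken k)

link-∈ : ∀ {a b l} → Link a b l → a ∈ˡ l
link-∈ here      = here refl
link-∈ (there k) = there (link-∈ k)

-- Repeating the base point makes the closing edge a `Link` like the others.
closed : ℕ → List ℕ → List ℕ
closed v m = v ∷ m ++ v ∷ []

link-rotate : ∀ {a b} v l u m → Link a b (closed v (l ++ u ∷ m)) → Link a b (closed u (m ++ v ∷ l))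
link-rotate {a} {b} v l u m k
  with link-split (v ∷ l) (subst (λ k → Link a b (v ∷ k)) (++-assoc l (u ∷ m) (v ∷ [])) k)
... | inj₁ k′ = subst (λ k → Link a b (u ∷ k)) (sym (++-assoc m (v ∷ l) (u ∷ []))) (link-++ʳ (u ∷ m) k′)
... | inj₂ k′ = subst (λ k → Link a b (u ∷ k)) (sym (++-assoc m (v ∷ l) (u ∷ []))) (link-++ˡ (u ∷ m) k′)

list-connected : ∀ {G a} l → a ∈ G → (∀ {x y} → Link x y (a ∷ l) → G ⊢ x ~ y) →
                 (∀ {x} → x ∈ G → x ∈ˡ a ∷ l) → Connected G
list-connected {G} {a} l a∈ links covers =
  (a , a∈) , λ x y x∈ y∈ → reverse (λ {i} {j} → edge-sym G i j) (along l links (covers x∈)) ◅◅ along l links (covers y∈)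
  where
  along : ∀ {a x} l → (∀ {x y} → Link x y (a ∷ l) → G ⊢ x ~ y) → x ∈ˡ a ∷ l → Star (G ⊢_~_) a x
  along l       links (here refl) = ε
  along (b ∷ l) links (there p)   = links here ◅ along l (λ k → links (there k)) p

-- `long` demands four points: in a triangle the rim of a point is a pair of adjacent points, not a
-- 0-sphere. `link⁻` excludes chords.
record IsCycle (G : DigitalSpace) (v : ℕ) (m : List ℕ) : Set where
  field
    unique : Unique (v ∷ m)
    long   : 3 ≤ length m
    list⁺  : ∀ {x} → x ∈ˡ v ∷ m → x ∈ G
    list⁻  : ∀ {x} → x ∈ G → x ∈ˡ v ∷ m
    link⁺  : ∀ {x y} → Link x y (closed v m) → G ⊢ x ~ y
    link⁻  : ∀ {x y} → G ⊢ x ~ y → Link x y (closed v m) ⊎ Link y x (closed v m)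

open IsCycle

-- Any point can serve as base, so local statements need proof only at the head of the list.
rotate : ∀ {G v} l u m → IsCycle G v (l ++ u ∷ m) → IsCycle G u (m ++ v ∷ l)
rotate {G} {v} l u m c = record
  { unique = Unique-resp-↭ perm (unique c)
  ; long   = subst (3 ≤_) (cong pred (↭-length perm)) (long c)
  ; list⁺  = λ p → list⁺ c (∈-resp-↭ (++-comm (u ∷ m) (v ∷ l)) p)
  ; list⁻  = λ p → ∈-resp-↭ perm (list⁻ c p)
  ; link⁺  = λ k → link⁺ c (link-rotate u m v l k)
  ; link⁻  = λ e → Sum.map (link-rotate v l u m) (link-rotate v l u m) (link⁻ c e)
  }
  where
  perm : v ∷ l ++ u ∷ m ↭ u ∷ m ++ v ∷ l
  perm = ++-comm (v ∷ l) (u ∷ m)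

cycle-neighbours : ∀ {G v a l k b} → IsCycle G v (a ∷ l) → a ∷ l ≡ k ++ b ∷ [] →
                   ∀ {x} → G ⊢ v ~ x → x ≡ a ⊎ x ≡ b
cycle-neighbours {G} {v} {a} {l} {k} {b} c eq {x} e with link⁻ c e
... | inj₁ here        = inj₁ refl
... | inj₁ (there p)   = ⊥-elim (Unique-head (unique c) (link-source (a ∷ l) p))
... | inj₂ p = inj₂ (predecessor (link-split (v ∷ k)
                 (subst (λ m → Link x v (v ∷ m)) (trans (cong (_++ v ∷ []) eq) (++-assoc k (b ∷ []) (v ∷ []))) p)))
  where
  predecessor : Link x v (v ∷ k ++ b ∷ []) ⊎ Link x v (b ∷ v ∷ []) → x ≡ b
  predecessor (inj₁ q) = ⊥-elim (Unique-head (unique c) (subst (v ∈ˡ_) (sym eq) (link-target q)))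
  predecessor (inj₂ here) = refl
  predecessor (inj₂ (there (there ())))

unsnoc : ∀ (x : ℕ) l → ∃[ k ] ∃[ b ] x ∷ l ≡ k ++ b ∷ []
unsnoc x []      = [] , x , refl
unsnoc x (y ∷ l) with k , b , eq ← unsnoc y l = x ∷ k , b , cong (x ∷_) eq

cycle-rim : ∀ {G v m} → IsCycle G v m → IsSphere 0 (rim G v)
cycle-rim {m = []} cyc with () ← long cyc
cycle-rim {m = _ ∷ []} cyc with s≤s () ← long cyc
cycle-rim {m = _ ∷ _ ∷ []} cyc with s≤s (s≤s ()) ← long cyc
cycle-rim {G} {v} {a ∷ c ∷ d ∷ l} cyc with k , b , d∷l≡ ← unsnoc d l =
  a , b , ∈-rim⁺ G v (link⁺ cyc here) , ∈-rim⁺ G v (edge-sym G b v (b~v d∷l≡)) ,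
  a≢b d∷l≡ , a≁b d∷l≡ , λ x x∈ → cycle-neighbours {k = a ∷ c ∷ k} cyc (m≡ d∷l≡) (∈-rim⁻ G v {x} x∈)
  where
  module _ {k b} (d∷l≡ : d ∷ l ≡ k ++ b ∷ []) where
    m≡ : a ∷ c ∷ d ∷ l ≡ (a ∷ c ∷ k) ++ b ∷ []
    m≡ = cong (λ t → a ∷ c ∷ t) d∷l≡
    b∈ : b ∈ˡ d ∷ l
    b∈ = subst (b ∈ˡ_) (sym d∷l≡) (∈-++⁺ʳ k (here refl))
    b~v : G ⊢ b ~ v
    b~v = link⁺ cyc (subst (λ t → Link b v (v ∷ t))
            (sym (trans (cong (_++ v ∷ []) m≡) (++-assoc (a ∷ c ∷ k) (b ∷ []) (v ∷ []))))
            (link-++ʳ (v ∷ a ∷ c ∷ k) here))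
    a≢b : a ≢ b
    a≢b refl = Unique-head (Unique-++⁻ʳ (v ∷ []) (unique cyc)) (there b∈)
    a≁b : ¬ (rim G v ⊢ a ~ b)
    -- With `a` as base, the neighbours of `a` are `c` and `v`; `b` is neither of them.
    a≁b e with cycle-neighbours {k = c ∷ d ∷ l} {v} (rotate [] a (c ∷ d ∷ l) cyc) refl (proj₁ (~-rim⁻ G v {a} {b} e))
    ... | inj₁ refl = Unique-head (Unique-++⁻ʳ (v ∷ a ∷ []) (unique cyc)) b∈
    ... | inj₂ refl = edge-irrefl G v b~v

cycle-rims : ∀ {G v m} → IsCycle G v m → ∀ u → u ∈ G → IsSphere 0 (rim G u)
cycle-rims {G} c u u∈ with list⁻ c u∈
... | here refl = cycle-rim c
... | there p with l , m , refl ← ∈-∃++ p = cycle-rim (rotate l u m c)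

-- What remains is a path, and `a` is an end of it because its neighbour `v` is gone.
cycle-delete : ∀ {N G v m} → Bounded N G → IsCycle G v m → Contractible (G - v)
cycle-delete {m = []} _ c with () ← long c
cycle-delete {N} {G} {v} {a ∷ l} bnd c =
  path-contractible _ (G - v) ≤-refl (bounded-delete G v bnd) (Connected⇒Conn {G - v} connected)
    (λ e₁ e₂ e₃ → deg2 (in-G e₁) (in-G e₂) (in-G e₃)) a∈ deg1
  where
  in-G : ∀ {x y} → G - v ⊢ x ~ y → G ⊢ x ~ y
  in-G e = proj₁ (~-⁻ G v e)
  deg2 : DegreeAtMost2 G
  deg2 = 1-sphere-degree {G} (cycle-rims c)
  ≢v : ∀ {x} → x ∈ˡ a ∷ l → x ≢ v
  ≢v p refl = Unique-head (unique c) p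
  a∈ : a ∈ G - v
  a∈ = ∈-⁺ G v (list⁺ c (there (here refl))) (≢v (here refl))
  links : ∀ {x y} → Link x y (a ∷ l) → G - v ⊢ x ~ y
  links k = ~-⁺ G v (link⁺ c (there (link-weaken k))) (≢v (link-∈ k)) (≢v (there (link-target k)))
  covers : ∀ {x} → x ∈ G - v → x ∈ˡ a ∷ l
  covers x∈ with x∈G , x≢v ← ∈-⁻ G v x∈ with list⁻ c x∈G
  ... | here x≡v = ⊥-elim (x≢v x≡v)
  ... | there p  = p
  connected : Connected (G - v)
  connected = list-connected {G - v} l a∈ links covers
  a~v : G ⊢ a ~ v
  a~v = edge-sym G v a (link⁺ c here)
  deg1 : DegreeAtMost1 (G - v) a
  deg1 e₁ e₂ with e₁ , _ , x≢v ← ~-⁻ G v e₁ | e₂ , _ , y≢v ← ~-⁻ G v e₂ with deg2 a~v e₁ e₂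
  ... | inj₁ v≡x        = ⊥-elim (x≢v (sym v≡x))
  ... | inj₂ (inj₁ x≡y) = x≡y
  ... | inj₂ (inj₂ v≡y) = ⊥-elim (y≢v (sym v≡y))

cycle-closedCurve : ∀ {N G v m} → Bounded N G → IsCycle G v m → ClosedCurve G
cycle-closedCurve {G = G} {v} {m} bnd c =
  list-connected {G} m (list⁺ c (here refl)) (λ k → link⁺ c (link-weaken k)) (list⁻ c) ,
  λ u u∈ → cycle-rims c u u∈ , deletion u u∈
  where
  deletion : ∀ u → u ∈ G → Contractible (G - u)
  deletion u u∈ with list⁻ c u∈
  ... | here refl = cycle-delete bnd c
  ... | there p with l , m , refl ← ∈-∃++ p = cycle-delete bnd (rotate l u m c)

T-∨⁻ : ∀ {a b} → T (a ∨ b) → T a ⊎ T b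
T-∨⁻ = Equivalence.to T-∨

linked : List ℕ → ℕ → ℕ → Bool
linked l x y = ⌊ link? x y l ⌋ ∨ ⌊ link? y x l ⌋

linked⁻ : ∀ l x y → T (linked l x y) → Link x y l ⊎ Link y x l
linked⁻ l x y t = Sum.map (toWitness {a? = link? x y l}) (toWitness {a? = link? y x l}) (T-∨⁻ {⌊ link? x y l ⌋} t)

linked⁺ : ∀ l x y → Link x y l ⊎ Link y x l → T (linked l x y)
linked⁺ l x y k = Equivalence.from T-∨ (Sum.map (fromWitness {a? = link? x y l}) (fromWitness {a? = link? y x l}) k)

-- Chords that the cycle has in `M` are dropped, as `⊆` permits. The factor `edge M` supplies
-- irreflexivity for arbitrary lists; it changes nothing once all links are edges of `M`.
cycleSpace : DigitalSpace → ℕ → List ℕ → DigitalSpace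
cycleSpace M v m = record
  { point       = λ x → ⌊ x ∈? v ∷ m ⌋
  ; edge        = λ x y → linked (closed v m) x y ∧ edge M x y
  ; edge-irrefl = λ x e → edge-irrefl M x (proj₂ (T-split {linked (closed v m) x x} e))
  ; edge-sym    = λ x y e → let k , e′ = T-split {linked (closed v m) x y} e in
      T-pair {linked (closed v m) y x} (linked⁺ (closed v m) y x (Sum.swap (linked⁻ (closed v m) x y k))) (edge-sym M x y e′)
  ; edge-point  = λ x y e → let k , _ = T-split {linked (closed v m) x y} e in
      fromWitness {a? = x ∈? v ∷ m} (source (linked⁻ (closed v m) x y k))
  }
  where
  source : ∀ {x y} → Link x y (closed v m) ⊎ Link y x (closed v m) → x ∈ˡ v ∷ m
  source (inj₁ k) = link-source (v ∷ m) k
  source (inj₂ k) with ∈-++⁻ m (link-target k)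
  ... | inj₁ p           = there p
  ... | inj₂ (here refl) = here refl

module _ (M : DigitalSpace) {v m} (links : ∀ {x y} → Link x y (closed v m) → M ⊢ x ~ y) where

  cycleSpace-⊆ : cycleSpace M v m ⊆ M
  cycleSpace-⊆ =
    (λ x x∈ → let y , k = link-successor (v ∷ m) (toWitness {a? = x ∈? v ∷ m} x∈) in edge-point M x y (links k)) ,
    (λ x y e → proj₂ (T-split {linked (closed v m) x y} e))

  cycleSpace-cycle : Unique (v ∷ m) → 3 ≤ length m → IsCycle (cycleSpace M v m) v m
  cycleSpace-cycle u long = record
    { unique = u
    ; long   = long
    ; list⁺  = λ {x} → fromWitness {a? = x ∈? v ∷ m}
    ; list⁻  = λ {x} → toWitness {a? = x ∈? v ∷ m}
    ; link⁺  = λ {x} {y} k → T-pair {linked (closed v m) x y} (linked⁺ (closed v m) x y (inj₁ k)) (links k)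
    ; link⁻  = λ {x} {y} e → linked⁻ (closed v m) x y (proj₁ (T-split {linked (closed v m) x y} e))
    }

-- Simple connectedness kills the first cohomology

weight : (ℕ → ℕ → Bool) → List ℕ → Bool
weight φ []          = false
weight φ (x ∷ [])    = false
weight φ (x ∷ y ∷ l) = φ x y xor weight φ (y ∷ l)

weight-split : ∀ φ l c m → weight φ (l ++ c ∷ m) ≡ weight φ (l ++ c ∷ []) xor weight φ (c ∷ m)
weight-split φ []          c m = refl
weight-split φ (x ∷ [])    c m = cong (_xor weight φ (c ∷ m)) (sym (xor-identityʳ (φ x c)))
weight-split φ (x ∷ y ∷ l) c m =
  trans (cong (φ x y xor_) (weight-split φ (y ∷ l) c m)) (sym (xor-assoc (φ x y) _ _))

weight-coboundary : ∀ {φ} {f : ℕ → Bool} a l z →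
                    (∀ {x y} → Link x y (a ∷ l ++ z ∷ []) → φ x y ≡ f x xor f y) →
                    weight φ (a ∷ l ++ z ∷ []) ≡ f a xor f z
weight-coboundary {φ} a [] z δ = trans (xor-identityʳ (φ a z)) (δ here)
weight-coboundary {φ} {f} a (b ∷ l) z δ =
  trans (cong₂ _xor_ (δ here) (weight-coboundary {φ} {f} b l z (λ k → δ (there k))))
        (solve 3 (λ p q r → (p :+ q) :+ (q :+ r) := p :+ r) refl (f a) (f b) (f z))

module _ {N} (M : DigitalSpace) (bound : Bounded N M) (simply : SimplyConnected M) {φ} (c : Cocycle M φ) where

  -- Simple connectedness speaks only of closed curves, which have at least four points. Shorter
  -- cycles are settled directly: an edge run back and forth cancels, and a triangle has weight zero
  -- by the cocycle condition.
  cycle-weight : ∀ v m → Unique (v ∷ m) → (∀ {x y} → Link x y (closed v m) → M ⊢ x ~ y) →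
                 weight φ (closed v m) ≡ false
  cycle-weight v [] u links = ⊥-elim (edge-irrefl M v (links here))
  cycle-weight v (a ∷ []) u links =
    trans (cong (λ b → φ v a xor (b xor false)) (symmetric c (links (there here))))
      (solve 1 (λ p → p :+ (p :+ con false) := con false) refl (φ v a))
  cycle-weight v (a ∷ b ∷ []) u links =
    trans (cong (λ t → φ v a xor (φ a b xor (t xor false)))
            (trans (symmetric c b~v) (sym (triangle c (links here) (links (there here)) (edge-sym M b v b~v)))))
      (solve 2 (λ p q → p :+ (q :+ ((p :+ q) :+ con false)) := con false) refl (φ v a) (φ a b))
    where
    b~v : M ⊢ b ~ v
    b~v = links (there (there here))
  cycle-weight v m@(_ ∷ _ ∷ _ ∷ _) u links
    -- On the contractible `A` around the curve `φ` is a coboundary, so the weight telescopes.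
    with A , contractible , C⊆A , A⊆M ← proj₂ simply (cycleSpace M v m)
           (cycle-closedCurve {N} (λ x x∈ → bound x (proj₁ (cycleSpace-⊆ M links) x x∈))
             (cycleSpace-cycle M links u (s≤s (s≤s (s≤s z≤n)))))
           (cycleSpace-⊆ M links)
    with f , δ ← contractible⇒acyclic contractible φ (cocycle-⊆ {M} {A} (λ {x} {y} → proj₂ A⊆M x y) c) =
    trans (weight-coboundary {φ} {f} v m v
            (λ {x} {y} k → δ (proj₂ C⊆A x y (link⁺ (cycleSpace-cycle M links u (s≤s (s≤s (s≤s z≤n)))) k))))
          (xor-same (f v))

  data Ends (b : ℕ) : List ℕ → Set where
    stop : Ends b (b ∷ [])
    _∷_  : ∀ x {l} → Ends b l → Ends b (x ∷ l)

  ends-∈ : ∀ {b l} → Ends b l → b ∈ˡ l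
  ends-∈ stop    = here refl
  ends-∈ (x ∷ e) = there (ends-∈ e)

  ends-suffix : ∀ {b} l {y m} → Ends b (l ++ y ∷ m) → Ends b (y ∷ m)
  ends-suffix []          e       = e
  ends-suffix (x ∷ [])    (_ ∷ e) = e
  ends-suffix (x ∷ z ∷ l) (_ ∷ e) = ends-suffix (z ∷ l) e

  record SimplePath (b x : ℕ) (w : Bool) : Set where
    field
      tail   : List ℕ
      ends   : Ends b (x ∷ tail)
      distinct : Unique (x ∷ tail)
      links  : ∀ {y z} → Link y z (x ∷ tail) → M ⊢ y ~ z
      weighs : weight φ (x ∷ tail) ≡ w

  -- If y is already on the path, the loop that closes at y is a cycle, of weight zero.
  extend : ∀ {b x w} y → M ⊢ y ~ x → SimplePath b x w → SimplePath b y (φ y x xor w)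
  extend {b} {x} {w} y y~x p with y ∈? x ∷ SimplePath.tail p
  ... | no y∉ = record
    { tail = x ∷ tail ; ends = y ∷ ends ; distinct = ¬Any⇒All¬ _ y∉ ∷ distinct
    ; links = λ { here → y~x ; (there k) → links k } ; weighs = cong (φ y x xor_) weighs }
    where open SimplePath p
  ... | yes y∈ with ∈-∃++ y∈
  ...   | [] , _ , refl = ⊥-elim (edge-irrefl M y y~x)
  ...   | _ ∷ l , m , refl = record
    { tail = m ; ends = ends-suffix (x ∷ l) ends ; distinct = Unique-++⁻ʳ (x ∷ l) distinct
    ; links = λ k → links (link-++ʳ (x ∷ l) k) ; weighs = suffix-weight }
    where
    open SimplePath p
    loop : weight φ (closed y (x ∷ l)) ≡ false
    loop = cycle-weight y (x ∷ l) (Unique-++⁻ˡ (y ∷ x ∷ l) (Unique-resp-↭ (shift y (x ∷ l) m) distinct))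
      λ { here → y~x ; (there k) → links (link-++ˡ (x ∷ l) k) }
    suffix-weight : weight φ (y ∷ m) ≡ φ y x xor w
    suffix-weight = begin
      weight φ (y ∷ m)
        ≡⟨ solve 2 (λ s t → s := t :+ (t :+ s)) refl (weight φ (y ∷ m)) (weight φ (x ∷ l ++ y ∷ [])) ⟩
      weight φ (x ∷ l ++ y ∷ []) xor (weight φ (x ∷ l ++ y ∷ []) xor weight φ (y ∷ m))
        ≡⟨ cong₂ _xor_ (sym (xor-cancel (φ y x) _ loop)) (trans (sym (weight-split φ (x ∷ l) y m)) weighs) ⟩
      φ y x xor w ∎
      where open ≡-Reasoning

  walk-weight : ∀ {x y} → Star (M ⊢_~_) x y → Bool
  walk-weight ε                 = false
  walk-weight (_◅_ {x} {y} _ s) = φ x y xor walk-weight s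

  erase-loops : ∀ {x b} (s : Star (M ⊢_~_) x b) → SimplePath b x (walk-weight s)
  erase-loops ε = record { tail = [] ; ends = stop ; distinct = [] ∷ [] ; links = λ { (there ()) } ; weighs = refl }
  erase-loops (_◅_ {x} e s) = extend x e (erase-loops s)

  -- Loop erasure keeps the weight and leaves a path without repetitions from `x` to `x`, which is
  -- the single point `x`: otherwise its head would recur at its end.
  closed-walk-weight : ∀ {x} (s : Star (M ⊢_~_) x x) → walk-weight s ≡ false
  closed-walk-weight s with erase-loops s
  ... | record { ends = stop ; weighs = w }            = sym w
  ... | record { ends = _ ∷ e ; distinct = u } = ⊥-elim (Unique-head u (ends-∈ e))

  walk-weight-◅◅ : ∀ {x y z} (s : Star (M ⊢_~_) x y) (t : Star (M ⊢_~_) y z) →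
                   walk-weight (s ◅◅ t) ≡ walk-weight s xor walk-weight t
  walk-weight-◅◅ ε t = refl
  walk-weight-◅◅ (_◅_ {x} {y} e s) t = trans (cong (φ x y xor_) (walk-weight-◅◅ s t)) (sym (xor-assoc (φ x y) _ _))

  simplyConnected-coboundary : ∃[ f ] φ isCoboundaryOf f on M
  simplyConnected-coboundary with (b , b∈) , path ← proj₁ simply = f , δ
    where
    value : ∀ x → Dec (x ∈ M) → Bool
    value x (yes x∈) = walk-weight (path b x b∈ x∈)
    -- A default that makes `f` total; no edge of `M` meets such a point.
    value x (no _)   = false
    f : ℕ → Bool
    f x = value x (T? (point M x))
    -- Independence of the path: the chosen path from `b` to `x`, followed by `s`, is a closed walk
    -- and has weight zero.
    f-path : ∀ {x} (s : Star (M ⊢_~_) x b) → x ∈ M → f x ≡ walk-weight s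
    f-path {x} s x∈ with T? (point M x)
    ... | yes x∈′ = xor-cancel _ _
            (trans (sym (walk-weight-◅◅ (path b x b∈ x∈′) s)) (closed-walk-weight (path b x b∈ x∈′ ◅◅ s)))
    ... | no x∉   = ⊥-elim (x∉ x∈)
    δ : φ isCoboundaryOf f on M
    δ {x} {y} e = begin
      φ x y
        ≡⟨ solve 2 (λ p q → p := (p :+ q) :+ q) refl (φ x y) (walk-weight s) ⟩
      (φ x y xor walk-weight s) xor walk-weight s
        ≡⟨ sym (cong₂ _xor_ (f-path (e ◅ s) (edge-point M x y e)) (f-path s (neighbour M e))) ⟩
      f x xor f y ∎
      where
      open ≡-Reasoning
      s : Star (M ⊢_~_) y b
      s = path y b (neighbour M e) b∈

proposition6p1 : (M : DigitalSpace) → Finite M → IsManifold 2 M → SimplyConnected M → IsSphere 2 M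
proposition6p1 M (N , bound) (_ , connected , link) simply = connected , λ v v∈ → link v v∈ , contractible v v∈
  where
  delete-conn : ∀ {v} → v ∈ M → Conn (M - v)
  delete-conn {v} v∈ = conn-delete {M} (Connected⇒Conn {M} connected)
    (Connected⇒Conn {rim M v} (proj₁ (link v v∈))) (∈-rim⁻ M v (proj₂ (proj₁ (proj₁ (link v v∈)))))
  acyclic : Acyclic M
  acyclic φ c = simplyConnected-coboundary M bound simply c
  contractible : ∀ v → v ∈ M → Contractible (M - v)
  -- `v` itself is the point that keeps the subgraph proper, and the root that survives is a point
  -- of its rim.
  contractible v v∈ = Surface.dismantle M N bound link delete-conn _ {M - v} ≤-refl (delete-fullIn {M} v full-in-itself)
    (delete-conn v∈) (PuncturedSurface.punctured-acyclic M N bound link v∈ acyclic)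
    v∈ (λ v∈′ → proj₂ (∈-⁻ M v v∈′) refl) u∈
    where
    v~u : M ⊢ v ~ proj₁ (proj₁ (proj₁ (link v v∈)))
    v~u = ∈-rim⁻ M v (proj₂ (proj₁ (proj₁ (link v v∈))))
    u∈ : proj₁ (proj₁ (proj₁ (link v v∈))) ∈ M - v
    u∈ = ∈-⁺ M v (neighbour M v~u) (λ eq → edge⇒≢ M v~u (sym eq))
    full-in-itself : M FullIn M
    full-in-itself = record { sub-point = λ x∈ → x∈ ; sub-edge = λ e → e ; full = λ _ _ e → e }
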